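{- Let $G$ be a finite directed acyclic graph with a unique source $s$, a unique sink $t$, inner vertices $[n]=\{1,\dots,n\}$, and no idle edges, satisfying degree equality, and let $\mathcal{R}=\{R_1<\cdots<R_k\}$ be an (ordered) route decomposition of $G$. Then the polytope $Q_{\mathcal{R}}=\varphi(\mathcal{F}_1(G))$ is full-dimensional in the linear subspace of $V^1\times\cdots\times V^n$ given by the intersection of the hyperplanes $\sum_{l\in\mathrm{inlevel}(i)}x^i_l=0$ for all $i\in[n]$. Its facets are given by the half-spaces $$\sum_{i\in[n]}\ \sum_{\substack{R\in\mathcal{R},\\ l\in\mathrm{inlevel}(R^{\mathrm{left}},i)}}x^i_l\ \le\ 1$$ with bounding hyperplanes $$H_M=\Big\{x\in V^1\times\cdots\times V^n\ :\ \sum_{i\in[n]}\ \sum_{\substack{R\in\mathcal{R},\\ l\in\mathrm{inlevel}(R^{\mathrm{left}},i)}}x^i_l=1\Big\},$$ one for each transversal $M=\{e_R:R\in\mathcal{R}\}$ of $\mathcal{R}$ such that for every inner vertex $v$ of $G$ there exists a route of $G$ incident to $v$ that uses no edge of $M$. (The sets $R^{\mathrm{left}}$ depend on $M$.)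
   Context: Directed graphs may have parallel edges. The vertices of $G$ are ordered $s<1<\cdots<n<t$ with every edge from a smaller to a larger vertex. An edge is idle if it is the only incoming or the only outgoing edge of some inner vertex. A route is a directed path from $s$ to $t$ (a sequence of edges). The flow polytope $\mathcal{F}_1(G)$ is the set of $x\in\mathbb{R}_{\ge 0}^{E(G)}$ with inflow equal to outflow at every inner vertex and total outflow $1$ at $s$; equivalently the convex hull of the indicator vectors of routes. Degree equality: $\mathrm{indeg}_G(v)=\mathrm{outdeg}_G(v)$ for all inner $v$. A route decomposition is a set $\mathcal{R}$ of routes whose edge sets partition $E(G)$. A transversal of $\mathcal{R}$ is a set $M=\{e_R:R\in\mathcal{R}\}$ with $e_R\in E(R)$ for each $R\in\mathcal{R}$. For an edge $e$, $\mathrm{label}(e)$ is the index $j$ of the unique $R_j\in\mathcal{R}$ containing $e$. For an inner vertex $i$, $\mathrm{inlevel}(i)$ is the set of labels of the edges entering $i$, and for $D\subseteq E(G)$, $\mathrm{inlevel}(D,i)$ is the set of labels of the edges of $D$ entering $i$. $V^i:=\mathbb{R}^{\mathrm{indeg}(i)}$ has standard basis $\{e^i_l:l\in\mathrm{inlevel}(i)\}$, with corresponding coordinates $x^i_l$. The linear map $\varphi:\mathbb{R}^{E(G)}\to V^1\times\cdots\times V^n$ is defined on the basis vector of an edge $e$ from $i$ to $j$ by $e^j_{\mathrm{label}(e)}-e^i_{\mathrm{label}(e)}$, where the summand for a vertex that is the source or sink is omitted (note that by degree equality the labels of edges leaving $i$ are exactly those of edges entering $i$). Given a transversal $\{e_R\}$,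 for each $R\in\mathcal{R}$ the set $R^{\mathrm{left}}\subseteq E(R)$ consists of the edges that $R$ uses before $e_R$. -}

module Defs where

open import Level using (Level; suc; _⊔_)
open import Algebra.Bundles using (CommutativeRing)
import Algebra.Definitions.RawMonoid as RawMonoidSum
open import Data.Bool.Base using (Bool; _∧_; if_then_else_)
open import Data.Fin.Base using (Fin; toℕ)
import Data.Fin.Properties as Fin
open import Data.Integer.Base as ℤ using (ℤ; _⊖_; 1ℤ)
open import Data.List.Base using (List; []; _∷_; length; lookup; filter; takeWhile; map; allFin)
open import Data.List.Membership.Propositional using (_∈_; _∉_)
import Data.List.Membership.DecPropositional as DecMembership
open import Data.Nat.Base as ℕ using (ℕ)
open import Data.Product using (Σ-syntax; ∃-syntax; ∃!; _×_; proj₁; proj₂)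
open import Data.Sum.Base using (_⊎_)
open import Function.Bundles using (_⇔_)
open import Relation.Binary.Core using (Rel)
open import Relation.Binary.Definitions using (DecidableEquality)
open import Relation.Binary.PropositionalEquality using (_≡_; _≢_; refl; cong)
open import Relation.Binary.Structures using (IsDecTotalOrder)
open import Relation.Nullary using (¬_; yes; no; does)
open import Relation.Nullary.Decidable using (map′; ¬?)
open import Relation.Unary using (Pred; _⊆_; _≐_; _∩_)

-- The scalars. Classically ℝ is an instance; the decidability of the order is
-- the usual trichotomy. Completeness is not assumed.
record OrderedField c ℓ₁ ℓ₂ : Set (suc (c ⊔ ℓ₁ ⊔ ℓ₂)) where
  infix 4 _≤_
  field
    commutativeRing : CommutativeRing c ℓ₁
  open CommutativeRing commutativeRing public
  field
    _≤_             : Rel Carrier ℓ₂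
    isDecTotalOrder : IsDecTotalOrder _≈_ _≤_
    +-monoˡ-≤       : ∀ z {x y} → x ≤ y → x + z ≤ y + z
    *-nonNeg        : ∀ {x y} → 0# ≤ x → 0# ≤ y → 0# ≤ x * y
    0≉1             : ¬ (0# ≈ 1#)
    inverse         : ∀ x → ¬ (x ≈ 0#) → ∃[ y ] x * y ≈ 1#

  open RawMonoidSum +-rawMonoid public using (sum)

------------------------------------------------------------------------
-- Graphs

data Vertex (n : ℕ) : Set where
  source : Vertex n
  inner  : Fin n → Vertex n
  sink   : Vertex n

private
  inner-injective : ∀ {n} {i j : Fin n} → inner i ≡ inner j → i ≡ j
  inner-injective refl = refl

infix 4 _≟_ _≺_

_≟_ : ∀ {n} → DecidableEquality (Vertex n)
source  ≟ source  = yes refl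
source  ≟ inner _ = no λ ()
source  ≟ sink    = no λ ()
inner _ ≟ source  = no λ ()
inner i ≟ inner j = map′ (cong inner) inner-injective (i Fin.≟ j)
inner _ ≟ sink    = no λ ()
sink    ≟ source  = no λ ()
sink    ≟ inner _ = no λ ()
sink    ≟ sink    = yes refl

rank : ∀ {n} → Vertex n → ℕ
rank     source    = 0
rank     (inner i) = ℕ.suc (toℕ i)
rank {n} sink      = ℕ.suc n

_≺_ : ∀ {n} → Vertex n → Vertex n → Set
u ≺ v = rank u ℕ.< rank v

-- Inner vertices are Fin n and edges are Fin m, so parallel edges are allowed.
record Graph (n m : ℕ) : Set where
  field
    src tgt : Fin m → Vertex n
    ordered : ∀ e → src e ≺ tgt e

module _ {n m} (G : Graph n m) where
  open Graph G

  IsSource IsSink : Vertex n → Set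
  IsSource v = ∀ e → tgt e ≢ v
  IsSink   v = ∀ e → src e ≢ v

  UniqueSource UniqueSink : Set
  UniqueSource = ∀ v → IsSource v ⇔ v ≡ source
  UniqueSink   = ∀ v → IsSink v ⇔ v ≡ sink

  Idle : Fin m → Set
  Idle e = ∃[ i ] ((tgt e ≡ inner i × (∀ e′ → tgt e′ ≡ inner i → e′ ≡ e))
                 ⊎ (src e ≡ inner i × (∀ e′ → src e′ ≡ inner i → e′ ≡ e)))

  NoIdleEdges : Set
  NoIdleEdges = ∀ e → ¬ Idle e

  entering leaving : List (Fin m) → Vertex n → List (Fin m)
  entering D v = filter (λ e → tgt e ≟ v) D
  leaving  D v = filter (λ e → src e ≟ v) D

  indeg outdeg : Vertex n → ℕ
  indeg  v = length (entering (allFin m) v)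
  outdeg v = length (leaving (allFin m) v)

  DegreeEquality : Set
  DegreeEquality = ∀ i → indeg (inner i) ≡ outdeg (inner i)

  IsPath : Vertex n → List (Fin m) → Vertex n → Set
  IsPath u []      v = u ≡ v
  IsPath u (e ∷ p) v = src e ≡ u × IsPath (tgt e) p v

  record Route : Set where
    field
      edges  : List (Fin m)
      isPath : IsPath source edges sink

  open Route

  IncidentTo : Route → Vertex n → Set
  IncidentTo P v = ∃[ e ] (e ∈ edges P × (src e ≡ v ⊎ tgt e ≡ v))

  -- An edge cannot occur twice in a route, because G is acyclic, and no route
  -- is empty, because source ≢ sink.
  record RouteDecomposition (k : ℕ) : Set where
    field
      route     : Fin k → Route
      partition : ∀ e → ∃! _≡_ (λ j → e ∈ edges (route j))

    label : Fin m → Fin k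
    label e = proj₁ (partition e)

module _ {n m k} {G : Graph n m} (R : RouteDecomposition G k) where
  open Graph G
  open Route
  open RouteDecomposition R

  inlevel : List (Fin m) → Fin n → List (Fin k)
  inlevel D i = map label (entering G D (inner i))

  -- As p runs over Fin (indeg i), this enumerates the labels of the edges
  -- entering i, each of them once.
  labelAt : (i : Fin n) → Fin (indeg G (inner i)) → Fin k
  labelAt i p = label (lookup (entering G (allFin m) (inner i)) p)

  record Transversal : Set where
    field
      pick   : Fin k → Fin m
      pick∈R : ∀ j → pick j ∈ edges (route j)

  open Transversal

  -- The routes are edge-disjoint, so this is equality of the edge sets.
  _≈ᵀ_ : Rel Transversal Level.zero
  M ≈ᵀ M′ = ∀ j → pick M j ≡ pick M′ j

  left : Transversal → Fin k → List (Fin m)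
  left M j = takeWhile (λ e → ¬? (e Fin.≟ pick M j)) (edges (route j))

  Avoids : Route G → Transversal → Set
  Avoids P M = ∀ j → pick M j ∉ edges P

  Coverable : Transversal → Set
  Coverable M = ∀ i → Σ[ P ∈ Route G ] (IncidentTo G P (inner i) × Avoids P M)

------------------------------------------------------------------------
-- Affine geometry of K^(d 0) × ⋯ × K^(d (n - 1))

module _ {c ℓ₁ ℓ₂} (K : OrderedField c ℓ₁ ℓ₂) where
  open OrderedField K

  [_] : Bool → Carrier
  [ b ] = if b then 1# else 0#

  Space : ∀ {n} → (Fin n → ℕ) → Set c
  Space {n} d = (i : Fin n) → Fin (d i) → Carrier

  module _ {n} {d : Fin n → ℕ} where

    ⟨_,_⟩ : Space d → Space d → Carrier
    ⟨ a , x ⟩ = sum λ i → sum λ p → a i p * x i p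

    AffinelyIndependent : ∀ {r} → (Fin r → Space d) → Set (c ⊔ ℓ₁)
    AffinelyIndependent {r} pt =
      (μ : Fin r → Carrier) → sum μ ≈ 0# →
      (∀ i p → sum (λ j → μ j * pt j i p) ≈ 0#) → ∀ j → μ j ≈ 0#

    IndependentIn : ∀ {ℓ} → Pred (Space d) ℓ → ℕ → Set (c ⊔ ℓ₁ ⊔ ℓ)
    IndependentIn S r =
      Σ[ pt ∈ (Fin r → Space d) ] ((∀ j → S (pt j)) × AffinelyIndependent pt)

    -- Dimension of the affine hull: one less than the largest number of
    -- affinely independent points, so that the empty set has dimension -1.
    HasDim : ∀ {ℓ} → Pred (Space d) ℓ → ℤ → Set (c ⊔ ℓ₁ ⊔ ℓ)
    HasDim S δ =
      ∃[ r ] (δ ≡ r ⊖ 1 × IndependentIn S r × (∀ r′ → IndependentIn S r′ → r′ ℕ.≤ r))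

    FullDimensionalIn : ∀ {ℓ ℓ′} → Pred (Space d) ℓ → Pred (Space d) ℓ′ → Set (c ⊔ ℓ₁ ⊔ ℓ ⊔ ℓ′)
    FullDimensionalIn S L = S ⊆ L × ∃[ δ ] (HasDim S δ × HasDim L δ)

    IsFace : ∀ {ℓ ℓ′} → Pred (Space d) ℓ → Pred (Space d) ℓ′ → Set (c ⊔ ℓ₁ ⊔ ℓ₂ ⊔ ℓ ⊔ ℓ′)
    IsFace S F = Σ[ a ∈ Space d ] ∃[ b ]
      ((∀ {x} → S x → ⟨ a , x ⟩ ≤ b) × F ≐ (S ∩ (λ x → ⟨ a , x ⟩ ≈ b)))

    IsFacet : ∀ {ℓ ℓ′} → Pred (Space d) ℓ → Pred (Space d) ℓ′ → Set (c ⊔ ℓ₁ ⊔ ℓ₂ ⊔ ℓ ⊔ ℓ′)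
    IsFacet S F = IsFace S F × ∃[ δ ] (HasDim S δ × HasDim F (δ ℤ.- 1ℤ))

------------------------------------------------------------------------
-- The flow polytope and its image under φ

  module _ {n m} (G : Graph n m) where
    open Graph G

    inflow outflow : (Fin m → Carrier) → Vertex n → Carrier
    inflow  x v = sum λ e → if does (tgt e ≟ v) then x e else 0#
    outflow x v = sum λ e → if does (src e ≟ v) then x e else 0#

    FlowPolytope : Pred (Fin m → Carrier) (ℓ₁ ⊔ ℓ₂)
    FlowPolytope x =
        (∀ e → 0# ≤ x e)
      × (∀ i → inflow x (inner i) ≈ outflow x (inner i))
      × outflow x source ≈ 1#

    V : Set c
    V = Space (λ i → indeg G (inner i))

    ZeroSums : Pred V ℓ₁
    ZeroSums x = ∀ i → sum (x i) ≈ 0#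

  module _ {n m k} {G : Graph n m} (R : RouteDecomposition G k) where
    open Graph G
    open RouteDecomposition R

    -- The basis vector e^v_l of V, read as 0 when v is the source or the sink.
    basis : Vertex n → Fin k → V G
    basis source    l i p = 0#
    basis (inner j) l i p = [ does (j Fin.≟ i) ∧ does (labelAt R i p Fin.≟ l) ]
    basis sink      l i p = 0#

    φ : (Fin m → Carrier) → V G
    φ x i p = sum λ e → x e * (basis (tgt e) (label e) i p - basis (src e) (label e) i p)

    Q : Pred (V G) (c ⊔ ℓ₁ ⊔ ℓ₂)
    Q y = ∃[ x ] (FlowPolytope G x × (∀ i p → φ x i p ≈ y i p))

    -- For fixed i and j, the innermost sum runs over the coordinates of y at i
    -- whose label lies in inlevel (left M j) i.
    leftSum : Transversal R → V G → Carrier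
    leftSum M y = sum λ i → sum λ j → sum λ p →
      if does (labelAt R i p ∈? inlevel R (left R M j) i) then y i p else 0#
      where open DecMembership Fin._≟_ using (_∈?_)

    HalfSpace : Transversal R → Pred (V G) ℓ₂
    HalfSpace M y = leftSum M y ≤ 1#

    H : Transversal R → Pred (V G) ℓ₁
    H M y = leftSum M y ≈ 1#

-- Write ⟨a, φ x⟩ = Σ x e · weight a e. The weights of a sum to 0 along each route
-- of R, so φ maps those routes to 0; following one route into an inner vertex and
-- another one out of it gives a difference of two basis vectors, so Q spans the
-- zero-sum subspace. The weights of the normal of H_M are 1 on edges leaving the
-- source minus 1 on M, hence Q ∩ H_M is the image of the flows that vanish on M.
--
-- If M is coverable and a vanishes on the routes avoiding M, then its weights off
-- M are differences of a potential; following each route of R from the end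
-- that does not meet M shows that a is constant at every inner vertex. So
-- Q ∩ H_M linearly spans the zero-sum subspace and is a facet.
--
-- Conversely, let a · y ≤ b be tight on a facet; then b > 0. Averaging flows over
-- a maximal independent family of the facet, every route of R has an edge on
-- which the average vanishes: otherwise subtract a small multiple of that route
-- (which φ kills), rescale, and exceed b. These edges form M. Adding 0 and any
-- point that distinguishes the facet from Q ∩ H_M to the family would exceed the
-- dimension of Q; so would adding 0 and a difference of basis vectors at a vertex
-- all of whose in-edges, or all of whose out-edges, lie in M.

module Submission where

open import Defs
open import Algebra.Bundles using (CommutativeRing)
open import Algebra.Bundles.Raw using (RawRing)
import Algebra.Properties.AbelianGroup
import Algebra.Properties.CommutativeMonoid.Sum
import Algebra.Properties.CommutativeSemigroup
import Algebra.Properties.Ring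
import Algebra.Properties.Semiring.Mult
import Algebra.Properties.Semiring.Sum
import Algebra.Solver.Ring
open import Algebra.Solver.Ring.AlmostCommutativeRing using (fromCommutativeRing; _-Raw-AlmostCommutative⟶_)
open import Data.Bool.Base using (Bool; true; false; if_then_else_)
open import Data.Empty using (⊥)
open import Data.Fin.Base as Fin using (Fin; zero; suc; punchIn; punchOut; splitAt; _↑ˡ_; _↑ʳ_)
import Data.Fin.Properties as Fin
import Data.Integer.Base as ℤ
import Data.Integer.Properties as ℤ
open import Data.List.Base as List using (List; []; _∷_; _++_; lookup; takeWhile; allFin)
import Data.List.Properties as List
open import Data.List.Membership.Propositional using (_∈_; _∉_)
import Data.List.Membership.DecPropositional as DecMembership
import Data.List.Membership.Propositional.Properties as ∈
open import Data.List.Relation.Unary.Any as Any using (Any; here; there)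
import Data.List.Relation.Unary.Any.Properties as Any
open import Data.Maybe.Base using (Maybe; just; nothing)
open import Data.Nat.Base as ℕ using (ℕ; zero; suc)
import Data.Nat.Properties as ℕ
open import Data.Product using (Σ; Σ-syntax; ∃₂; ∃-syntax; ∃!; _×_; _,_; proj₁; proj₂)
open import Data.Sum.Base using (_⊎_; inj₁; inj₂; [_,_]′)
import Data.Vec.Functional as Vec
import Data.Vec.Functional.Properties as Vec
import Data.Product.Properties as Product
open import Function.Base using (_∘_; case_of_)
open import Function.Bundles using (Equivalence)
open import Level using (_⊔_)
open import Relation.Binary.PropositionalEquality as ≡ using (_≡_; _≢_)
import Relation.Binary.Reasoning.Setoid
open import Relation.Binary.Structures using (IsDecTotalOrder)
open import Relation.Nullary using (¬_; Dec; yes; no; does; contradiction)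
open import Relation.Nullary.Decidable using (dec-true; dec-false; ¬?; _×-dec_; decidable-stable)
open import Relation.Unary using (Pred; _⊆_; _≐_; _∩_)
import Data.List.Relation.Unary.All as All
open import Data.List.Relation.Unary.Unique.Propositional using (Unique; []; _∷_)
import Data.List.Relation.Unary.Unique.Propositional.Properties as Unique

-- The ring solver with integer coefficients, each written as a difference of
-- two naturals, so that it sees cancellations.
module RingSolver {c ℓ} (R : CommutativeRing c ℓ) where
  open CommutativeRing R
  open Algebra.Properties.AbelianGroup +-abelianGroup using (⁻¹-anti-homo‿-; ⁻¹-∙-comm; x∙y⁻¹≈ε⇒x≈y; ε⁻¹≈ε)
  open Algebra.Properties.Ring (CommutativeRing.ring R) using (-‿distribˡ-*; -‿distribʳ-*)
  open Algebra.Properties.CommutativeSemigroup +-commutativeSemigroup using (interchange)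
  open Algebra.Properties.Semiring.Mult semiring
    using (×-homo-+; ×1-homo-*) renaming (_×_ to _∙_)
  open Relation.Binary.Reasoning.Setoid setoid

  private
    ⟦_⟧′ : ℕ × ℕ → Carrier
    ⟦ a , b ⟧′ = a ∙ 1# - b ∙ 1#

    differences : RawRing _ _
    differences = record
      { Carrier = ℕ × ℕ
      ; _≈_     = _≡_
      ; _+_     = λ { (a , b) (a′ , b′) → a ℕ.+ a′ , b ℕ.+ b′ }
      ; _*_     = λ { (a , b) (a′ , b′) → a ℕ.* a′ ℕ.+ b ℕ.* b′ , a ℕ.* b′ ℕ.+ b ℕ.* a′ }
      ; -_      = λ { (a , b) → b , a }
      ; 0#      = 0 , 0
      ; 1#      = 1 , 0
      }

    difference-+ : ∀ x y z w → (x + y) - (z + w) ≈ (x - z) + (y - w)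
    difference-+ x y z w = trans (+-congˡ (sym (⁻¹-∙-comm z w))) (interchange x y (- z) (- w))

    difference-* : ∀ x y z w → (x * z + y * w) - (x * w + y * z) ≈ (x - y) * (z - w)
    difference-* x y z w = begin
      (x * z + y * w) - (x * w + y * z)         ≈⟨ +-congˡ (-‿cong (+-comm _ _)) ⟩
      (x * z + y * w) - (y * z + x * w)         ≈⟨ difference-+ _ _ _ _ ⟩
      (x * z - y * z) + (y * w - x * w)         ≈⟨ +-congˡ (⁻¹-anti-homo‿- _ _) ⟨
      (x * z - y * z) - (x * w - y * w)         ≈⟨ +-cong (factor z) (-‿cong (factor w)) ⟩
      (x - y) * z - (x - y) * w                 ≈⟨ +-congˡ (-‿distribʳ-* _ _) ⟩
      (x - y) * z + (x - y) * - w               ≈⟨ distribˡ _ _ _ ⟨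
      (x - y) * (z - w)                         ∎
      where
      factor : ∀ t → x * t - y * t ≈ (x - y) * t
      factor t = trans (+-congˡ (-‿distribˡ-* y t)) (sym (distribʳ t x (- y)))

    morphism : differences -Raw-AlmostCommutative⟶ fromCommutativeRing R
    morphism = record
      { ⟦_⟧    = ⟦_⟧′
      ; +-homo = λ { (a , b) (a′ , b′) →
          trans (+-cong (×-homo-+ 1# a a′) (-‿cong (×-homo-+ 1# b b′))) (difference-+ _ _ _ _) }
      ; *-homo = λ { (a , b) (a′ , b′) →
          trans (+-cong (homo a a′ b b′) (-‿cong (homo a b′ b a′))) (difference-* _ _ _ _) }
      ; -‿homo = λ { (a , b) → sym (⁻¹-anti-homo‿- _ _) }
      ; 0-homo = -‿inverseʳ 0#
      ; 1-homo = trans (+-congˡ ε⁻¹≈ε) (trans (+-identityʳ _) (+-identityʳ 1#))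
      }
      where
      homo : ∀ a b c d → (a ℕ.* b ℕ.+ c ℕ.* d) ∙ 1# ≈ a ∙ 1# * b ∙ 1# + c ∙ 1# * d ∙ 1#
      homo a b c d = trans (×-homo-+ 1# (a ℕ.* b) (c ℕ.* d)) (+-cong (×1-homo-* a b) (×1-homo-* c d))

    _coeff≟_ : ∀ x y → Maybe (⟦ x ⟧′ ≈ ⟦ y ⟧′)
    (a , b) coeff≟ (a′ , b′) with a ℕ.+ b′ ℕ.≟ b ℕ.+ a′
    ... | no  _  = nothing
    ... | yes eq = just (x∙y⁻¹≈ε⇒x≈y _ _ (begin
      (a ∙ 1# - b ∙ 1#) - (a′ ∙ 1# - b′ ∙ 1#)     ≈⟨ +-congˡ (⁻¹-anti-homo‿- _ _) ⟩
      (a ∙ 1# - b ∙ 1#) + (b′ ∙ 1# - a′ ∙ 1#)     ≈⟨ difference-+ _ _ _ _ ⟨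
      (a ∙ 1# + b′ ∙ 1#) - (b ∙ 1# + a′ ∙ 1#)     ≈⟨ +-cong (×-homo-+ 1# a b′) (-‿cong (×-homo-+ 1# b a′)) ⟨
      (a ℕ.+ b′) ∙ 1# - (b ℕ.+ a′) ∙ 1#           ≡⟨ ≡.cong (λ t → t ∙ 1# - (b ℕ.+ a′) ∙ 1#) eq ⟩
      (b ℕ.+ a′) ∙ 1# - (b ℕ.+ a′) ∙ 1#           ≈⟨ -‿inverseʳ _ ⟩
      0#                                          ∎))

  open Algebra.Solver.Ring differences (fromCommutativeRing R) morphism _coeff≟_ public
    using (solve; _:=_; _:+_; _:*_; _:-_; :-_)

-- Ordered fields: signs, indicators and finite sums

module OrderedFieldProperties {c ℓ₁ ℓ₂} (K : OrderedField c ℓ₁ ℓ₂) where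
  open OrderedField K public hiding (zero)
  open IsDecTotalOrder isDecTotalOrder public
    using (total; antisym; ≤-respˡ-≈; ≤-respʳ-≈)
    renaming (_≟_ to _≈?_; refl to ≤-refl; trans to ≤-trans)
  open RingSolver commutativeRing public
  open Algebra.Properties.CommutativeMonoid.Sum +-commutativeMonoid public
    using (sum-cong-≋; sum-replicate-zero; sum-remove; ∑-distrib-+; ∑-comm)
  open Algebra.Properties.Semiring.Sum semiring public
    using (*-distribˡ-sum; *-distribʳ-sum)
  open Algebra.Properties.AbelianGroup +-abelianGroup public
    using () renaming (x∙y⁻¹≈ε⇒x≈y to x-y≈0⇒x≈y; ε⁻¹≈ε to -0≈0)
  open Relation.Binary.Reasoning.Setoid setoid public

  ≤-reflexive : ∀ {x y} → x ≈ y → x ≤ y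
  ≤-reflexive x≈y = ≤-respʳ-≈ x≈y ≤-refl

  x-0≈x : ∀ x → x - 0# ≈ x
  x-0≈x x = trans (+-congˡ -0≈0) (+-identityʳ x)

  x≤y⇒0≤y-x : ∀ {x y} → x ≤ y → 0# ≤ y - x
  x≤y⇒0≤y-x {x} x≤y = ≤-respˡ-≈ (-‿inverseʳ x) (+-monoˡ-≤ (- x) x≤y)

  0≤y-x⇒x≤y : ∀ {x y} → 0# ≤ y - x → x ≤ y
  0≤y-x⇒x≤y {x} {y} 0≤y-x = ≤-respˡ-≈ (+-identityˡ x)
    (≤-respʳ-≈ (solve 2 (λ y x → y :- x :+ x := y) refl y x) (+-monoˡ-≤ x 0≤y-x))

  +-nonNeg : ∀ {x y} → 0# ≤ x → 0# ≤ y → 0# ≤ x + y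
  +-nonNeg {x} {y} 0≤x 0≤y = ≤-trans 0≤y (≤-respˡ-≈ (+-identityˡ y) (+-monoˡ-≤ y 0≤x))

  +-nonNeg-zeroˡ : ∀ {x y} → 0# ≤ x → 0# ≤ y → x + y ≈ 0# → x ≈ 0#
  +-nonNeg-zeroˡ {x} {y} 0≤x 0≤y x+y≈0 = antisym x≤0 0≤x
    where
    x≤0 : x ≤ 0#
    x≤0 = 0≤y-x⇒x≤y (≤-respʳ-≈ (begin
      y             ≈⟨ solve 2 (λ x y → y := x :+ y :- x) refl x y ⟩
      x + y - x     ≈⟨ +-congʳ x+y≈0 ⟩
      0# - x        ∎) 0≤y)

  +-nonNeg-zeroʳ : ∀ {x y} → 0# ≤ x → 0# ≤ y → x + y ≈ 0# → y ≈ 0#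
  +-nonNeg-zeroʳ 0≤x 0≤y x+y≈0 = +-nonNeg-zeroˡ 0≤y 0≤x (trans (+-comm _ _) x+y≈0)

  *-cancel-zero : ∀ {x y} → ¬ x ≈ 0# → x * y ≈ 0# → y ≈ 0#
  *-cancel-zero {x} {y} x≉0 xy≈0 with inverse x x≉0
  ... | x⁻¹ , xx⁻¹≈1 = begin
    y               ≈⟨ *-identityʳ y ⟨
    y * 1#          ≈⟨ *-congˡ xx⁻¹≈1 ⟨
    y * (x * x⁻¹)   ≈⟨ solve 3 (λ x y z → y :* (x :* z) := (x :* y) :* z) refl x y x⁻¹ ⟩
    (x * y) * x⁻¹   ≈⟨ *-congʳ xy≈0 ⟩
    0# * x⁻¹        ≈⟨ zeroˡ x⁻¹ ⟩
    0#              ∎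

  *-cancel-zeroʳ : ∀ {x y} → ¬ y ≈ 0# → x * y ≈ 0# → x ≈ 0#
  *-cancel-zeroʳ y≉0 xy≈0 = *-cancel-zero y≉0 (trans (*-comm _ _) xy≈0)

  0≤x*x : ∀ x → 0# ≤ x * x
  0≤x*x x with total 0# x
  ... | inj₁ 0≤x = *-nonNeg 0≤x 0≤x
  ... | inj₂ x≤0 = ≤-respʳ-≈ (begin
    (0# - x) * (0# - x)             ≈⟨ solve 2 (λ z x → (z :- x) :* (z :- x) := z :* (z :- x :- x) :+ x :* x) refl 0# x ⟩
    0# * (0# - x - x) + x * x       ≈⟨ +-congʳ (zeroˡ _) ⟩
    0# + x * x                      ≈⟨ +-identityˡ _ ⟩
    x * x                           ∎) (*-nonNeg (x≤y⇒0≤y-x x≤0) (x≤y⇒0≤y-x x≤0))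

  0≤1 : 0# ≤ 1#
  0≤1 = ≤-respʳ-≈ (*-identityˡ 1#) (0≤x*x 1#)

  -- The inverse `y` equals `x * (y * y)`, a product of nonnegative factors.
  inverse-nonNeg : ∀ {x y} → 0# ≤ x → x * y ≈ 1# → 0# ≤ y
  inverse-nonNeg {x} {y} 0≤x xy≈1 = ≤-respʳ-≈ (begin
    x * (y * y)   ≈⟨ *-assoc x y y ⟨
    x * y * y     ≈⟨ *-congʳ xy≈1 ⟩
    1# * y        ≈⟨ *-identityˡ y ⟩
    y             ∎) (*-nonNeg 0≤x (0≤x*x y))

  half : ∃[ h ] (0# ≤ h × h + h ≈ 1#)
  -- If `1# + 1#` were zero, its nonnegative summands would be zero too.
  half with inverse (1# + 1#) (λ 2≈0 → 0≉1 (sym (+-nonNeg-zeroˡ 0≤1 0≤1 2≈0)))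
  ... | h , 2h≈1 = h , inverse-nonNeg (+-nonNeg 0≤1 0≤1) 2h≈1 ,
    trans (+-cong (sym (*-identityˡ h)) (sym (*-identityˡ h))) (trans (sym (distribʳ h 1# 1#)) 2h≈1)

  infix 8 𝟙
  𝟙 : Bool → Carrier
  𝟙 b = [_] K b

  0≤𝟙 : ∀ b → 0# ≤ 𝟙 b
  0≤𝟙 true  = 0≤1
  0≤𝟙 false = ≤-refl

  if≈*𝟙 : ∀ b x → (if b then x else 0#) ≈ x * 𝟙 b
  if≈*𝟙 true  x = sym (*-identityʳ x)
  if≈*𝟙 false x = sym (zeroʳ x)

  𝟙-yes : ∀ {p} {P : Set p} (P? : Dec P) → P → 𝟙 (does P?) ≈ 1#
  𝟙-yes P? p = reflexive (≡.cong 𝟙 (dec-true P? p))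

  𝟙-no : ∀ {p} {P : Set p} (P? : Dec P) → ¬ P → 𝟙 (does P?) ≈ 0#
  𝟙-no P? ¬p = reflexive (≡.cong 𝟙 (dec-false P? ¬p))

  𝟙-cong : ∀ {p q} {P : Set p} {Q : Set q} (P? : Dec P) (Q? : Dec Q) →
           (P → Q) → (Q → P) → 𝟙 (does P?) ≈ 𝟙 (does Q?)
  𝟙-cong (yes p) Q? f g = sym (𝟙-yes Q? (f p))
  𝟙-cong (no ¬p) Q? f g = sym (𝟙-no Q? (¬p ∘ g))

  sum-cong : ∀ {n} {f g : Fin n → Carrier} → (∀ i → f i ≈ g i) → sum f ≈ sum g
  sum-cong = sum-cong-≋

  sum-zero : ∀ {n} {f : Fin n → Carrier} → (∀ i → f i ≈ 0#) → sum f ≈ 0#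
  sum-zero {n} f≈0 = trans (sum-cong f≈0) (sum-replicate-zero n)

  sum-single : ∀ {n} {f : Fin n → Carrier} i → (∀ j → j ≢ i → f j ≈ 0#) → sum f ≈ f i
  sum-single {f = f} zero    f≈0 =
    trans (+-congˡ (sum-zero (λ j → f≈0 (suc j) λ ()))) (+-identityʳ (f zero))
  sum-single {f = f} (suc i) f≈0 =
    trans (+-cong (f≈0 zero λ ()) (sum-single i (λ j j≢i → f≈0 (suc j) (j≢i ∘ Fin.suc-injective))))
          (+-identityˡ (f (suc i)))

  sum-- : ∀ {n} (f g : Fin n → Carrier) → sum (λ i → f i - g i) ≈ sum f - sum g
  sum-- {zero}  f g = sym (-‿inverseʳ 0#)
  sum-- {suc n} f g = trans (+-congˡ (sum-- (f ∘ suc) (g ∘ suc)))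
    (solve 4 (λ x y s t → (x :- y) :+ (s :- t) := (x :+ s) :- (y :+ t)) refl
       (f zero) (g zero) (sum (f ∘ suc)) (sum (g ∘ suc)))

  sum-nonNeg : ∀ {n} {f : Fin n → Carrier} → (∀ i → 0# ≤ f i) → 0# ≤ sum f
  sum-nonNeg {zero}  0≤f = ≤-refl
  sum-nonNeg {suc n} 0≤f = +-nonNeg (0≤f zero) (sum-nonNeg (0≤f ∘ suc))

  sum-nonNeg-zero : ∀ {n} {f : Fin n → Carrier} → (∀ i → 0# ≤ f i) → sum f ≈ 0# → ∀ i → f i ≈ 0#
  sum-nonNeg-zero 0≤f s≈0 zero    = +-nonNeg-zeroˡ (0≤f zero) (sum-nonNeg (0≤f ∘ suc)) s≈0
  sum-nonNeg-zero 0≤f s≈0 (suc i) =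
    sum-nonNeg-zero (0≤f ∘ suc) (+-nonNeg-zeroʳ (0≤f zero) (sum-nonNeg (0≤f ∘ suc)) s≈0) i

-- Finite enumerations of index sets

record Enumeration {a p} {A : Set a} (P : A → Set p) : Set (a ⊔ p) where
  field
    size      : ℕ
    index     : Fin size → A
    sound     : ∀ t → P (index t)
    complete  : ∀ x → P x → ∃[ t ] index t ≡ x
    injective : ∀ {s t} → index s ≡ index t → s ≡ t

others : ∀ {m} (p : Fin m) → Enumeration (_≢ p)
others {suc m} p = record
  { size      = m
  ; index     = punchIn p
  ; sound     = Fin.punchInᵢ≢i p
  ; complete  = λ x x≢p → punchOut (x≢p ∘ ≡.sym) , Fin.punchIn-punchOut (x≢p ∘ ≡.sym)
  ; injective = Fin.punchIn-injective p _ _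
  }

-- By induction on `n`: the enumeration of the fibre over `zero` is followed by the shifted
-- enumeration of the other fibres.
Σ-enumeration : ∀ {n a p} {A : Fin n → Set a} {P : ∀ i → A i → Set p} →
                (∀ i → Enumeration (P i)) → Enumeration {A = Σ (Fin n) A} (λ (i , x) → P i x)
Σ-enumeration {zero}  E = record
  { size = 0 ; index = λ () ; sound = λ () ; complete = λ () ; injective = λ { {()} } }
Σ-enumeration {suc n} {A = A} {P} E = record
  { size      = E₀.size ℕ.+ E₊.size
  ; index     = index ∘ splitAt E₀.size
  ; sound     = sound ∘ splitAt E₀.size
  ; complete  = complete
  ; injective = λ {s} {t} eq → ≡.trans (≡.sym (Fin.join-splitAt E₀.size E₊.size s))
      (≡.trans (≡.cong (Fin.join E₀.size E₊.size) (injective (splitAt E₀.size s) (splitAt E₀.size t) eq))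
               (Fin.join-splitAt E₀.size E₊.size t))
  }
  where
  module E₀ = Enumeration (E zero)
  module E₊ = Enumeration (Σ-enumeration (E ∘ suc))
  shift : Σ (Fin n) (A ∘ suc) → Σ (Fin (suc n)) A
  shift (i , x) = suc i , x
  index : Fin E₀.size ⊎ Fin E₊.size → Σ (Fin (suc n)) A
  index (inj₁ s) = zero , E₀.index s
  index (inj₂ t) = shift (E₊.index t)
  sound : ∀ t → P (proj₁ (index t)) (proj₂ (index t))
  sound (inj₁ s) = E₀.sound s
  sound (inj₂ t) = E₊.sound t
  complete : ∀ ix → P (proj₁ ix) (proj₂ ix) → ∃[ t ] index (splitAt E₀.size t) ≡ ix
  complete (zero , x) Px with E₀.complete x Px
  ... | s , eq = s ↑ˡ E₊.size ,
    ≡.trans (≡.cong index (Fin.splitAt-↑ˡ E₀.size s E₊.size)) (≡.cong (zero ,_) eq)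
  complete (suc i , x) Px with E₊.complete (i , x) Px
  ... | t , eq = E₀.size ↑ʳ t ,
    ≡.trans (≡.cong index (Fin.splitAt-↑ʳ E₀.size E₊.size t)) (≡.cong shift eq)
  shift-injective : ∀ {x y} → shift x ≡ shift y → x ≡ y
  shift-injective ≡.refl = ≡.refl
  injective : ∀ s t → index s ≡ index t → s ≡ t
  injective (inj₁ s) (inj₁ t) eq = ≡.cong inj₁ (E₀.injective (zero-injective eq))
    where
    zero-injective : ∀ {x y : A zero} → _≡_ {A = Σ (Fin (suc n)) A} (zero , x) (zero , y) → x ≡ y
    zero-injective ≡.refl = ≡.refl
  injective (inj₁ s) (inj₂ t) ()
  injective (inj₂ s) (inj₁ t) ()
  injective (inj₂ s) (inj₂ t) eq = ≡.cong inj₂ (E₊.injective (shift-injective eq))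

-- Linear equations, independence and the space of zero sums

module LinearAlgebra {c ℓ₁ ℓ₂} (K : OrderedField c ℓ₁ ℓ₂) where
  open OrderedFieldProperties K

  -- Gaussian elimination, without divisions: the pivot row and each other row
  -- are cross-multiplied.
  underdetermined : ∀ {q u} → q ℕ.< u → (A : Fin q → Fin u → Carrier) →
    Σ[ x ∈ (Fin u → Carrier) ] ((∃[ j ] ¬ x j ≈ 0#) × (∀ i → sum (λ j → A i j * x j) ≈ 0#))
  underdetermined {zero}  {suc u} _ A = (λ _ → 1#) , (zero , λ 1≈0 → 0≉1 (sym 1≈0)) , λ ()
  underdetermined {suc q} {suc u} q<u A with Fin.any? (λ j → ¬? (A zero j ≈? 0#))
  -- The first equation has only zero coefficients, so a solution of the others suffices.
  ... | no no-pivot = x , x≉0 , λ where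
      zero    → sum-zero (λ j → trans (*-congʳ (row≈0 j)) (zeroˡ (x j)))
      (suc i) → Ax≈0 i
    where
    row≈0 : ∀ j → A zero j ≈ 0#
    row≈0 j = decidable-stable (A zero j ≈? 0#) (λ ≉0 → no-pivot (j , ≉0))
    rest = underdetermined (ℕ.<-trans (ℕ.n<1+n q) q<u) (A ∘ suc)
    x = proj₁ rest
    x≉0 = proj₁ (proj₂ rest)
    Ax≈0 = proj₂ (proj₂ rest)
  -- The solution is nonzero at `punchIn j k₀`, where it is the pivot `a` times a nonzero value of
  -- `y`.
  ... | yes (j , a≉0) = x , (punchIn j k₀ , λ x≈0 → y≉0 (*-cancel-zero a≉0
                              (trans (reflexive (≡.sym (x-punchIn k₀))) x≈0))) , λ where
      zero    → trans (row zero) (sum-zero λ k → trans (*-congʳ (-‿inverseʳ _)) (zeroˡ (y k)))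
      (suc i) → trans (row (suc i)) (A′y≈0 i)
    where
    a = A zero j
    reduced : Fin (suc q) → Fin u → Carrier
    reduced i k = a * A i (punchIn j k) - A i j * A zero (punchIn j k)
    rest = underdetermined (ℕ.s<s⁻¹ q<u) (reduced ∘ suc)
    y = proj₁ rest
    k₀ = proj₁ (proj₁ (proj₂ rest))
    y≉0 = proj₂ (proj₁ (proj₂ rest))
    A′y≈0 = proj₂ (proj₂ rest)
    -- Because the other unknowns are scaled by `a`, the factor `a` comes out of the whole pivot
    -- equation and this value solves it without division.
    xⱼ = - sum (λ k → A zero (punchIn j k) * y k)
    x : Fin (suc u) → Carrier
    x = Vec.insertAt (λ k → a * y k) j xⱼ
    x-punchIn : ∀ k → x (punchIn j k) ≡ a * y k
    x-punchIn = Vec.insertAt-punchIn (λ k → a * y k) j xⱼ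
    -- For the pivot row the reduced coefficients cancel; for every other row they are those of the
    -- smaller system that `y` solves.
    row : ∀ i → sum (λ k → A i k * x k) ≈ sum (λ k → reduced i k * y k)
    row i = begin
      sum (λ k → A i k * x k)
        ≈⟨ sum-remove {i = j} (λ k → A i k * x k) ⟩
      A i j * x j + sum (λ k → A i (punchIn j k) * x (punchIn j k))
        ≈⟨ +-cong (*-congˡ (reflexive (Vec.insertAt-lookup (λ k → a * y k) j xⱼ)))
                  (sum-cong λ k → *-congˡ (reflexive (x-punchIn k))) ⟩
      A i j * - sum (λ k → A zero (punchIn j k) * y k) + sum (λ k → A i (punchIn j k) * (a * y k))
        ≈⟨ solve 3 (λ b s t → b :* (:- s) :+ t := t :- b :* s) refl _ _ _ ⟩
      sum (λ k → A i (punchIn j k) * (a * y k)) - A i j * sum (λ k → A zero (punchIn j k) * y k)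
        ≈⟨ +-congˡ (-‿cong (*-distribˡ-sum (A i j) (λ k → A zero (punchIn j k) * y k))) ⟩
      sum (λ k → A i (punchIn j k) * (a * y k)) - sum (λ k → A i j * (A zero (punchIn j k) * y k))
        ≈⟨ sum-- (λ k → A i (punchIn j k) * (a * y k)) (λ k → A i j * (A zero (punchIn j k) * y k)) ⟨
      sum (λ k → A i (punchIn j k) * (a * y k) - A i j * (A zero (punchIn j k) * y k))
        ≈⟨ (sum-cong λ k → solve 5 (λ e a y b f → e :* (a :* y) :- b :* (f :* y) := (a :* e :- b :* f) :* y)
                                   refl (A i (punchIn j k)) a (y k) (A i j) (A zero (punchIn j k))) ⟩
      sum (λ k → reduced i k * y k) ∎

  module _ {n} {d : Fin n → ℕ} where

    infix 7 _·_
    _·_ : Space K d → Space K d → Carrier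
    a · x = ⟨_,_⟩ K a x

    ·-congˡ : ∀ {a x y} → (∀ i p → x i p ≈ y i p) → a · x ≈ a · y
    ·-congˡ x≈y = sum-cong λ i → sum-cong λ p → *-congˡ (x≈y i p)

    ·-comm : ∀ a x → a · x ≈ x · a
    ·-comm a x = sum-cong λ i → sum-cong λ p → *-comm (a i p) (x i p)

    ·-zeroʳ : ∀ a → a · (λ _ _ → 0#) ≈ 0#
    ·-zeroʳ a = sum-zero λ i → sum-zero λ p → zeroʳ (a i p)

    ·-- : ∀ a x y → a · (λ i p → x i p - y i p) ≈ a · x - a · y
    ·-- a x y = begin
      sum (λ i → sum λ p → a i p * (x i p - y i p))
        ≈⟨ (sum-cong λ i → trans (sum-cong λ p →
              solve 3 (λ a x y → a :* (x :- y) := a :* x :- a :* y) refl (a i p) (x i p) (y i p))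
              (sum-- (λ p → a i p * x i p) (λ p → a i p * y i p))) ⟩
      sum (λ i → sum (λ p → a i p * x i p) - sum (λ p → a i p * y i p))
        ≈⟨ sum-- (λ i → sum (λ p → a i p * x i p)) (λ i → sum (λ p → a i p * y i p)) ⟩
      a · x - a · y ∎

    ·-∑ : ∀ {r} a (μ : Fin r → Carrier) (v : Fin r → Space K d) →
          a · (λ i p → sum λ j → μ j * v j i p) ≈ sum (λ j → μ j * (a · v j))
    ·-∑ a μ v = begin
      sum (λ i → sum λ p → a i p * sum λ j → μ j * v j i p)
        ≈⟨ (sum-cong λ i → sum-cong λ p → trans (*-distribˡ-sum (a i p) (λ j → μ j * v j i p))
              (sum-cong λ j → solve 3 (λ a m v → a :* (m :* v) := m :* (a :* v)) refl (a i p) (μ j) (v j i p))) ⟩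
      sum (λ i → sum λ p → sum λ j → μ j * (a i p * v j i p))
        ≈⟨ (sum-cong λ i → trans (∑-comm λ p j → μ j * (a i p * v j i p))
              (sum-cong λ j → sym (*-distribˡ-sum (μ j) (λ p → a i p * v j i p)))) ⟩
      sum (λ i → sum λ j → μ j * sum λ p → a i p * v j i p)
        ≈⟨ trans (∑-comm λ i j → μ j * sum λ p → a i p * v j i p)
                 (sum-cong λ j → sym (*-distribˡ-sum (μ j) (λ i → sum λ p → a i p * v j i p))) ⟩
      sum (λ j → μ j * (a · v j)) ∎

    unit : Σ (Fin n) (Fin ∘ d) → Space K d
    unit ip i p = 𝟙 (does (Product.≡-dec Fin._≟_ Fin._≟_ ip (i , p)))

    unit-≡ : ∀ i p → unit (i , p) i p ≈ 1#
    unit-≡ i p = 𝟙-yes (Product.≡-dec Fin._≟_ Fin._≟_ (i , p) (i , p)) ≡.refl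

    unit-≢ : ∀ ip i p → ip ≢ (i , p) → unit ip i p ≈ 0#
    unit-≢ ip i p = 𝟙-no (Product.≡-dec Fin._≟_ Fin._≟_ ip (i , p))

    unit-· : ∀ i p x → unit (i , p) · x ≈ x i p
    unit-· i p x = begin
      unit (i , p) · x
        ≈⟨ sum-single i (λ j j≢i → sum-zero {d j} λ q →
             trans (*-congʳ (unit-≢ (i , p) j q λ eq → j≢i (≡.sym (≡.cong proj₁ eq)))) (zeroˡ (x j q))) ⟩
      sum (λ q → unit (i , p) i q * x i q)
        ≈⟨ sum-single p (λ q q≢p →
             trans (*-congʳ (unit-≢ (i , p) i q λ { ≡.refl → q≢p ≡.refl })) (zeroˡ (x i q))) ⟩
      unit (i , p) i p * x i p
        ≈⟨ trans (*-congʳ (unit-≡ i p)) (*-identityˡ (x i p)) ⟩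
      x i p ∎

    LinearlyIndependent : ∀ {r} → (Fin r → Space K d) → Set (c ⊔ ℓ₁)
    LinearlyIndependent {r} pt =
      (μ : Fin r → Carrier) → (∀ i p → sum (λ j → μ j * pt j i p) ≈ 0#) → ∀ j → μ j ≈ 0#

    linearly⇒affinely : ∀ {r} {pt : Fin r → Space K d} → LinearlyIndependent pt → AffinelyIndependent K pt
    linearly⇒affinely ind μ _ = ind μ

    -- Linear independence kills the coefficients of `pt`; the coefficient of the origin then
    -- vanishes because all coefficients sum to zero.
    0∷-affinely : ∀ {r} {pt : Fin r → Space K d} → LinearlyIndependent pt →
                  AffinelyIndependent K ((λ _ _ → 0#) Vec.∷ pt)
    0∷-affinely {pt = pt} ind μ Σμ≈0 dep = λ where
        zero    → trans (sym (+-identityʳ (μ zero))) (trans (+-congˡ (sym (sum-zero tail≈0))) Σμ≈0)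
        (suc j) → tail≈0 j
      where
      tail≈0 : ∀ j → μ (suc j) ≈ 0#
      tail≈0 = ind (μ ∘ suc) λ i p →
        trans (sym (trans (+-congʳ (zeroʳ (μ zero))) (+-identityˡ _))) (dep i p)

    -- Pairing a dependence with `a` leaves only the term of `z`.
    linearly-∷ : ∀ {r} {pt : Fin r → Space K d} a z → LinearlyIndependent pt →
                 (∀ j → a · pt j ≈ 0#) → ¬ a · z ≈ 0# → LinearlyIndependent (z Vec.∷ pt)
    linearly-∷ {pt = pt} a z ind a·pt≈0 a·z≉0 μ dep = λ where
        zero    → μ₀≈0
        (suc j) → ind (μ ∘ suc) (λ i p → trans
          (sym (trans (+-congʳ (trans (*-congʳ μ₀≈0) (zeroˡ (z i p)))) (+-identityˡ _))) (dep i p)) j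
      where
      μ₀≈0 : μ zero ≈ 0#
      μ₀≈0 = *-cancel-zeroʳ a·z≉0 (begin
        μ zero * (a · z)
          ≈⟨ +-identityʳ _ ⟨
        μ zero * (a · z) + 0#
          ≈⟨ +-congˡ (sum-zero λ j → trans (*-congˡ (a·pt≈0 j)) (zeroʳ _)) ⟨
        μ zero * (a · z) + sum (λ j → μ (suc j) * (a · pt j))
          ≈⟨ ·-∑ a μ (z Vec.∷ pt) ⟨
        a · (λ i p → sum λ j → μ j * (z Vec.∷ pt) j i p)
          ≈⟨ ·-congˡ {a} dep ⟩
        a · (λ _ _ → 0#)
          ≈⟨ ·-zeroʳ a ⟩
        0# ∎)

    -- Pair a dependence with `a` and subtract `b` times the sum of the coefficients: only
    -- `μ zero * (a · z - b)` is left.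
    affinely-∷ : ∀ {r} {pt : Fin r → Space K d} a b z → AffinelyIndependent K pt →
                 (∀ j → a · pt j ≈ b) → ¬ a · z ≈ b → AffinelyIndependent K (z Vec.∷ pt)
    affinely-∷ {pt = pt} a b z ind a·pt≈b a·z≉b μ Σμ≈0 dep = λ where
        zero    → μ₀≈0
        (suc j) → ind (μ ∘ suc)
          (trans (sym (trans (+-congʳ μ₀≈0) (+-identityˡ _))) Σμ≈0)
          (λ i p → trans
            (sym (trans (+-congʳ (trans (*-congʳ μ₀≈0) (zeroˡ (z i p)))) (+-identityˡ _))) (dep i p)) j
      where
      μ₀≈0 : μ zero ≈ 0#
      μ₀≈0 = *-cancel-zeroʳ (a·z≉b ∘ x-y≈0⇒x≈y (a · z) b) (begin
        μ zero * (a · z - b)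
          ≈⟨ solve 4 (λ m s z b → m :* (z :- b) := (m :* z :+ s :* b) :- (m :+ s) :* b) refl
               (μ zero) (sum (μ ∘ suc)) (a · z) b ⟩
        (μ zero * (a · z) + sum (μ ∘ suc) * b) - (μ zero + sum (μ ∘ suc)) * b
          ≈⟨ +-cong (+-congˡ (trans (*-distribʳ-sum b (μ ∘ suc)) (sum-cong λ j → *-congˡ (sym (a·pt≈b j)))))
                    (-‿cong (trans (*-congʳ Σμ≈0) (zeroˡ b))) ⟩
        (μ zero * (a · z) + sum (λ j → μ (suc j) * (a · pt j))) - 0#
          ≈⟨ x-0≈x _ ⟩
        μ zero * (a · z) + sum (λ j → μ (suc j) * (a · pt j))
          ≈⟨ ·-∑ a μ (z Vec.∷ pt) ⟨
        a · (λ i p → sum λ j → μ j * (z Vec.∷ pt) j i p)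
          ≈⟨ ·-congˡ {a} dep ⟩
        a · (λ _ _ → 0#)
          ≈⟨ ·-zeroʳ a ⟩
        0# ∎)

  -- The coordinates other than p₀ i are coordinates on the subspace of zero sums.
  module ZeroSumSpace {n} {d : Fin n → ℕ} (p₀ : ∀ i → Fin (d i)) where

    open Enumeration (Σ-enumeration {A = Fin ∘ d} (others ∘ p₀)) public
      renaming (size to dim)

    -- An affine dependence has to solve `suc dim` equations, one for the sum of the coefficients
    -- and one per enumerated coordinate. The omitted coordinate at each `i` then vanishes as well,
    -- since the coordinates at `i` sum to zero. With more than `suc dim` points there are more
    -- unknowns than equations.
    independent-bound : ∀ {r} (pt : Fin r → Space K d) → (∀ j i → sum (pt j i) ≈ 0#) →
                        AffinelyIndependent K pt → r ℕ.≤ suc dim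
    independent-bound {r} pt zeroSum ind = ℕ.≮⇒≥ λ dim<r →
      let μ , (j , μⱼ≉0) , eqs = underdetermined dim<r rows
          at : ∀ i p → p ≢ p₀ i → sum (λ j → μ j * pt j i p) ≈ 0#
          at i p p≢ = case complete (i , p) p≢ of λ where
            (t , ≡.refl) → trans (sum-cong λ j → *-comm (μ j) _) (eqs (suc t))
          total≈0 : ∀ i → sum (λ p → sum λ j → μ j * pt j i p) ≈ 0#
          total≈0 i = trans (∑-comm λ p j → μ j * pt j i p)
            (sum-zero λ j → trans (sym (*-distribˡ-sum (μ j) (pt j i)))
              (trans (*-congˡ (zeroSum j i)) (zeroʳ (μ j))))
          dep : ∀ i p → sum (λ j → μ j * pt j i p) ≈ 0#
          dep i p = case p Fin.≟ p₀ i of λ where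
            (yes ≡.refl) → trans (sym (sum-single (p₀ i) (at i))) (total≈0 i)
            (no p≢)      → at i p p≢
      in μⱼ≉0 (ind μ (trans (sum-cong λ j → sym (*-identityˡ (μ j))) (eqs zero)) dep j)
      where
      rows : Fin (suc dim) → Fin r → Carrier
      rows zero    j = 1#
      rows (suc t) j = pt j (proj₁ (index t)) (proj₂ (index t))

    -- Functionals that are constant on each block vanish on zero sums; this condition picks one
    -- representative modulo them.
    Normalised : Space K d → Set ℓ₁
    Normalised a = ∀ i → a i (p₀ i) ≈ 0#

    -- The family grows one point at a time. As long as it has fewer than `dim` points, some nonzero
    -- normalised functional vanishes on all of them, and a point of `S` on which that functional
    -- does not vanish can be added.
    exists-independent : ∀ {ℓ} (S : Pred (Space K d) ℓ) →
      (∀ a → Normalised a → ∃₂ (λ i p → ¬ a i p ≈ 0#) → ∃[ z ] (S z × ¬ a · z ≈ 0#)) →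
      ∀ r → r ℕ.≤ dim → Σ[ pt ∈ (Fin r → Space K d) ] ((∀ j → S (pt j)) × LinearlyIndependent pt)
    exists-independent S separate zero    _     = (λ ()) , (λ ()) , λ μ _ ()
    exists-independent S separate (suc r) r<dim =
      let pt , pt∈S , ind       = exists-independent S separate r (ℕ.<⇒≤ r<dim)
          μ , (t , μₜ≉0) , eqs  = underdetermined r<dim (λ j t → pt j · unit (index t))
          -- The solution `μ` is read as the coordinates of a functional that is zero at every
          -- omitted coordinate.
          a : Space K d
          a i p = sum λ t → μ t * unit (index t) i p
          aₜ≈μₜ : a (proj₁ (index t)) (proj₂ (index t)) ≈ μ t
          aₜ≈μₜ = trans (sum-single t λ s s≢t →
                    trans (*-congˡ (unit-≢ (index s) _ _ (s≢t ∘ injective))) (zeroʳ (μ s)))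
                    (trans (*-congˡ (unit-≡ (proj₁ (index t)) (proj₂ (index t)))) (*-identityʳ (μ t)))
          a·pt≈0 : ∀ j → a · pt j ≈ 0#
          a·pt≈0 j = trans (·-comm a (pt j)) (trans (·-∑ (pt j) μ (unit ∘ index))
                    (trans (sum-cong λ t → *-comm (μ t) _) (eqs j)))
          normalised : Normalised a
          normalised i = sum-zero λ s → trans (*-congˡ (unit-≢ (index s) i (p₀ i) (subst-sound s))) (zeroʳ (μ s))
          z , z∈S , a·z≉0 = separate a normalised (_ , _ , λ aₜ≈0 → μₜ≉0 (trans (sym aₜ≈μₜ) aₜ≈0))
      in z Vec.∷ pt , (λ { zero → z∈S ; (suc j) → pt∈S j }) , linearly-∷ a z ind a·pt≈0 a·z≉0
      where
      subst-sound : ∀ s {i} → index s ≢ (i , p₀ i)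
      subst-sound s eq = ≡.subst (λ (i , p) → p ≢ p₀ i) eq (sound s) ≡.refl

-- Lists without repetition and directed paths

lookup-injective : ∀ {a} {A : Set a} {xs : List A} → Unique xs →
                   ∀ {p q} → lookup xs p ≡ lookup xs q → p ≡ q
lookup-injective (_    ∷ _) {zero}  {zero}  _  = ≡.refl
lookup-injective (x∉xs ∷ _) {zero}  {suc q} eq = contradiction eq (All.lookup x∉xs (∈.∈-lookup q))
lookup-injective (x∉xs ∷ _) {suc p} {zero}  eq = contradiction (≡.sym eq) (All.lookup x∉xs (∈.∈-lookup p))
lookup-injective (_ ∷ xs!)  {suc p} {suc q} eq = ≡.cong suc (lookup-injective xs! eq)

module Paths {n m} (G : Graph n m) where
  open Graph G

  path-++ : ∀ {u v w} p {q} → IsPath G u p v → IsPath G v q w → IsPath G u (p ++ q) w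
  path-++ []      ≡.refl         path-q = path-q
  path-++ (e ∷ p) (src≡ , path-p) path-q = src≡ , path-++ p path-p path-q

  record Split (u : Vertex n) (p : List (Fin m)) (e : Fin m) (v : Vertex n) : Set where
    field
      before after : List (Fin m)
      ≡-++         : p ≡ before ++ e ∷ after
      path-before  : IsPath G u before (src e)
      path-after   : IsPath G (tgt e) after v

  split : ∀ {u v e p} → IsPath G u p v → e ∈ p → Split u p e v
  split (≡.refl , path) (here ≡.refl) = record
    { before = [] ; after = _ ; ≡-++ = ≡.refl ; path-before = ≡.refl ; path-after = path }
  split {p = x ∷ p} (src≡ , path) (there e∈p) = record
    { before = x ∷ before ; after = after ; ≡-++ = ≡.cong (x ∷_) ≡-++
    ; path-before = src≡ , path-before ; path-after = path-after }
    where open Split (split path e∈p)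

  rank-mono : ∀ {u v} p → IsPath G u p v → rank u ℕ.≤ rank v
  rank-mono []      ≡.refl           = ℕ.≤-refl
  rank-mono (e ∷ p) (≡.refl , path) = ℕ.≤-trans (ℕ.<⇒≤ (ordered e)) (rank-mono p path)

  edge-bounds : ∀ {u v e p} → IsPath G u p v → e ∈ p → rank u ℕ.≤ rank (src e) × rank (tgt e) ℕ.≤ rank v
  edge-bounds path e∈p = rank-mono _ path-before , rank-mono _ path-after
    where open Split (split path e∈p)

  -- Ranks increase along a path, so whichever edge comes first ends no later than the other one
  -- starts. Positions in the list can thus be compared through ranks alone.
  path-order : ∀ {u v e e′ p} → IsPath G u p v → e ∈ p → e′ ∈ p →
               e ≡ e′ ⊎ rank (tgt e) ℕ.≤ rank (src e′) ⊎ rank (tgt e′) ℕ.≤ rank (src e)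
  path-order path       (here ≡.refl) (here ≡.refl) = inj₁ ≡.refl
  path-order (_ , path) (here ≡.refl) (there e′∈p)  = inj₂ (inj₁ (proj₁ (edge-bounds path e′∈p)))
  path-order (_ , path) (there e∈p)   (here ≡.refl) = inj₂ (inj₂ (proj₁ (edge-bounds path e∈p)))
  path-order (_ , path) (there e∈p)   (there e′∈p)  = path-order path e∈p e′∈p

  edge-irrefl : ∀ {e} → ¬ rank (tgt e) ℕ.≤ rank (src e)
  edge-irrefl {e} = ℕ.<⇒≱ (ordered e)

  -- If one edge came strictly before the other, the common target would have rank at most that of
  -- the source of the later edge.
  same-tgt : ∀ {u v e e′ p} → IsPath G u p v → e ∈ p → e′ ∈ p → tgt e ≡ tgt e′ → e ≡ e′
  same-tgt {e = e} {e′} path e∈p e′∈p eq with path-order path e∈p e′∈p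
  ... | inj₁ e≡e′      = e≡e′
  ... | inj₂ (inj₁ le) = contradiction (≡.subst (λ v → rank v ℕ.≤ rank (src e′)) eq le) (edge-irrefl {e′})
  ... | inj₂ (inj₂ le) = contradiction (≡.subst (λ v → rank v ℕ.≤ rank (src e)) (≡.sym eq) le) (edge-irrefl {e})

  next-edge : ∀ {u v e p} → IsPath G u p v → e ∈ p → tgt e ≢ v → ∃[ e′ ] (e′ ∈ p × src e′ ≡ tgt e)
  next-edge {p = _ ∷ []}     (_ , ≡.refl)    (here ≡.refl) tgt≢ = contradiction ≡.refl tgt≢
  next-edge {p = _ ∷ e′ ∷ p} (_ , src≡ , _) (here ≡.refl) tgt≢ = e′ , there (here ≡.refl) , src≡
  next-edge {p = _ ∷ _}      (_ , path)     (there e∈p)   tgt≢ =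
    let e′ , e′∈p , eq = next-edge path e∈p tgt≢ in e′ , there e′∈p , eq

  previous-edge : ∀ {u v e p} → IsPath G u p v → e ∈ p → src e ≢ u → ∃[ e′ ] (e′ ∈ p × tgt e′ ≡ src e)
  previous-edge (src≡ , _) (here ≡.refl) src≢ = contradiction src≡ src≢
  previous-edge {e = e} {x ∷ p} (_ , path) (there e∈p) src≢ with src e ≟ tgt x
  ... | yes eq = x , here ≡.refl , ≡.sym eq
  ... | no ≢x  = let e′ , e′∈p , eq = previous-edge path e∈p ≢x in e′ , there e′∈p , eq

  -- With `∈-takeWhile⁺` this replaces lying before `q` in the list by an inequality of ranks, which
  -- is how `left` is handled from here on.
  ∈-takeWhile⁻ : ∀ {u v q p e} → IsPath G u p v → q ∈ p →
                 e ∈ takeWhile (λ e → ¬? (e Fin.≟ q)) p → e ∈ p × rank (tgt e) ℕ.≤ rank (src q)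
  ∈-takeWhile⁻ {q = q} {x ∷ p} (_ , path) q∈ e∈ with x Fin.≟ q | q∈ | e∈
  ... | no x≢q | here q≡x  | _            = contradiction (≡.sym q≡x) x≢q
  ... | no x≢q | there q∈p | here ≡.refl  = here ≡.refl , proj₁ (edge-bounds path q∈p)
  ... | no x≢q | there q∈p | there e∈′    =
    let e∈p , le = ∈-takeWhile⁻ path q∈p e∈′ in there e∈p , le

  ∈-takeWhile⁺ : ∀ {u v q p e} → IsPath G u p v → q ∈ p →
                 e ∈ p → rank (tgt e) ℕ.≤ rank (src q) → e ∈ takeWhile (λ e → ¬? (e Fin.≟ q)) p
  ∈-takeWhile⁺ {q = q} {x ∷ p} {e} (_ , path) q∈ e∈ le with x Fin.≟ q | q∈ | e∈
  ... | yes ≡.refl | _         | here ≡.refl = contradiction le (edge-irrefl {e})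
  ... | yes ≡.refl | _         | there e∈p   = contradiction
    (ℕ.≤-trans (proj₁ (edge-bounds path e∈p)) (ℕ.≤-trans (ℕ.<⇒≤ (ordered e)) le)) (edge-irrefl {q})
  ... | no x≢q     | here q≡x  | _           = contradiction (≡.sym q≡x) x≢q
  ... | no x≢q     | there q∈p | here ≡.refl = here ≡.refl
  ... | no x≢q     | there q∈p | there e∈p   = there (∈-takeWhile⁺ path q∈p e∈p le)

  tgt≢source : ∀ e → tgt e ≢ source
  tgt≢source e eq with ≡.subst (λ v → rank (src e) ℕ.< rank v) eq (ordered e)
  ... | ()

  rank≤sink : ∀ (v : Vertex n) → rank v ℕ.≤ suc n
  rank≤sink source    = ℕ.z≤n
  rank≤sink (inner i) = ℕ.s≤s (ℕ.<⇒≤ (Fin.toℕ<n i))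
  rank≤sink sink      = ℕ.≤-refl

  src≢sink : ∀ e → src e ≢ sink
  src≢sink e eq = ℕ.<⇒≱ (≡.subst (λ v → rank v ℕ.< rank (tgt e)) eq (ordered e)) (rank≤sink (tgt e))

-- Route decompositions: labels, coordinates and left parts

module Decomposition {n m k} {G : Graph n m} (R : RouteDecomposition G k) where
  open Graph G
  open Paths G public
  open RouteDecomposition R
  open Route

  routeOf : Fin m → List (Fin m)
  routeOf e = edges (route (label e))

  ∈-routeOf : ∀ e → e ∈ routeOf e
  ∈-routeOf e = proj₁ (proj₂ (partition e))

  label-unique : ∀ {e j} → e ∈ edges (route j) → label e ≡ j
  label-unique {e} = proj₂ (proj₂ (partition e))

  route-path : ∀ j → IsPath G source (edges (route j)) sink
  route-path j = isPath (route j)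

  ∈-route : ∀ {e j} → label e ≡ j → e ∈ edges (route j)
  ∈-route {e} ≡.refl = ∈-routeOf e

  entry : ∀ i → Fin (indeg G (inner i)) → Fin m
  entry i p = lookup (entering G (allFin m) (inner i)) p

  tgt-entry : ∀ i p → tgt (entry i p) ≡ inner i
  tgt-entry i p = proj₂ (∈.∈-filter⁻ (λ e → tgt e ≟ inner i) {xs = allFin m} (∈.∈-lookup p))

  entry-surjective : ∀ {i e} → tgt e ≡ inner i → ∃[ p ] entry i p ≡ e
  entry-surjective {i} {e} eq = Any.index e∈ , ≡.sym (Any.lookup-index e∈)
    where e∈ = ∈.∈-filter⁺ (λ e → tgt e ≟ inner i) (∈.∈-allFin e) eq

  entry-injective : ∀ {i p q} → entry i p ≡ entry i q → p ≡ q
  entry-injective {i} = lookup-injective (Unique.filter⁺ (λ e → tgt e ≟ inner i) (Unique.allFin⁺ m))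

  -- A route enters a vertex by at most one edge, so edges entering `i` have different labels.
  labelAt-injective : ∀ {i p q} → labelAt R i p ≡ labelAt R i q → p ≡ q
  labelAt-injective {i} {p} {q} eq = entry-injective
    (same-tgt (route-path _) (∈-route eq) (∈-routeOf (entry i q))
              (≡.trans (tgt-entry i p) (≡.sym (tgt-entry i q))))

  slot-in : ∀ {i e} → tgt e ≡ inner i → ∃[ p ] labelAt R i p ≡ label e
  slot-in tgt≡ = let p , eq = entry-surjective tgt≡ in p , ≡.cong label eq

  -- The route of `e` does not start at the inner vertex `i`, so it enters `i` by an edge with the
  -- label of `e`.
  slot-out : ∀ {i e} → src e ≡ inner i → ∃[ p ] labelAt R i p ≡ label e
  slot-out {i} {e} src≡
    with previous-edge (route-path (label e)) (∈-routeOf e) (λ eq → inner≢source (≡.trans (≡.sym src≡) eq))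
    where
    inner≢source : inner i ≢ source
    inner≢source ()
  ... | e′ , e′∈ , tgt≡ = let p , eq = slot-in (≡.trans tgt≡ src≡) in p , ≡.trans eq (label-unique e′∈)

  -- Some edge enters `i`, since `source` is the only vertex without incoming edges; were it the
  -- only one, it would be idle.
  two-slots : UniqueSource G → NoIdleEdges G → ∀ i → Σ[ p ∈ Fin (indeg G (inner i)) ] ∃[ q ] q ≢ p
  two-slots unique-source no-idle i with Fin.any? (λ e → tgt e ≟ inner i)
  ... | no  no-edge    = case Equivalence.to (unique-source (inner i)) (λ e eq → no-edge (e , eq)) of λ ()
  ... | yes (e , tgt≡) with Fin.any? (λ e′ → (tgt e′ ≟ inner i) ×-dec ¬? (e′ Fin.≟ e))
  ...   | yes (e′ , tgt′≡ , e′≢e) =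
    let p , p≡ = entry-surjective tgt≡
        q , q≡ = entry-surjective tgt′≡
    in p , q , λ q≡p → e′≢e (≡.trans (≡.sym q≡) (≡.trans (≡.cong (entry i) q≡p) p≡))
  ...   | no  only-e = contradiction
    (i , inj₁ (tgt≡ , λ e′ tgt′≡ → decidable-stable (e′ Fin.≟ e) λ e′≢e → only-e (e′ , tgt′≡ , e′≢e)))
    (no-idle e)

  record Branches (i : Fin n) (l : Fin k) : Set where
    field
      into out  : List (Fin m)
      path-into : IsPath G source into (inner i)
      path-out  : IsPath G (inner i) out sink
      split-at  : into ++ out ≡ edges (route l)

  branches : ∀ i p → Branches i (labelAt R i p)
  branches i p = record
    { into      = before ++ entry i p ∷ []
    ; out       = after
    ; path-into = path-++ before path-before (≡.refl , tgt-entry i p)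
    ; path-out  = ≡.subst (λ v → IsPath G v after sink) (tgt-entry i p) path-after
    ; split-at  = ≡.trans (List.++-assoc before _ after) (≡.sym ≡-++)
    }
    where open Split (split (route-path (labelAt R i p)) (∈-routeOf (entry i p)))

  module _ (M : Transversal R) where
    open Transversal M

    Picked : Fin m → Set
    Picked e = e ≡ pick (label e)

    picked? : ∀ e → Dec (Picked e)
    picked? e = e Fin.≟ pick (label e)

    label-pick : ∀ j → label (pick j) ≡ j
    label-pick j = label-unique (pick∈R j)

    picked-pick : ∀ j → Picked (pick j)
    picked-pick j = ≡.cong pick (≡.sym (label-pick j))

    -- The vertex does not come after the start of the picked edge of route `l`. Being stated by
    -- rank, this makes sense also for vertices off that route; an edge of route `l` lies in the
    -- left part exactly when its target is early.
    Early : Fin k → Vertex n → Set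
    Early l v = rank v ℕ.≤ rank (src (pick l))

    -- Edges of `left R M j` carry the label `j`, so only one route can contribute a given label.
    ∈-inlevel-left : ∀ {i p j} → labelAt R i p ∈ inlevel R (left R M j) i →
                     j ≡ labelAt R i p × Early j (inner i)
    ∈-inlevel-left {i} {p} {j} l∈ with ∈.∈-map⁻ label l∈
    ... | e , e∈ , l≡ with ∈.∈-filter⁻ (λ e → tgt e ≟ inner i) {xs = left R M j} e∈
    ...   | e∈left , tgt≡ with ∈-takeWhile⁻ (route-path j) (pick∈R j) e∈left
    ...     | e∈R , le = ≡.sym (≡.trans l≡ (label-unique e∈R)) ,
                         ≡.subst (Early j) tgt≡ le

    inlevel-left-∈ : ∀ i p → Early (labelAt R i p) (inner i) →
                     labelAt R i p ∈ inlevel R (left R M (labelAt R i p)) i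
    inlevel-left-∈ i p early = ∈.∈-map⁺ label (∈.∈-filter⁺ (λ e → tgt e ≟ inner i)
      (∈-takeWhile⁺ (route-path _) (pick∈R _) (∈-routeOf (entry i p))
                    (≡.subst (Early _) (≡.sym (tgt-entry i p)) early))
      (tgt-entry i p))

-- Pairing functionals with images of flows

module Flows {c ℓ₁ ℓ₂} (K : OrderedField c ℓ₁ ℓ₂) {n m k} {G : Graph n m} (R : RouteDecomposition G k) where
  open OrderedFieldProperties K public
  open LinearAlgebra K public
  open Decomposition R public
  open Graph G
  open RouteDecomposition R

  -- The coordinate of `a` at `v` with label `l`, extended by zero to the source, the sink and
  -- labels that do not occur at `v`.
  α : V K G → Vertex n → Fin k → Carrier
  α a v l = a · basis K R v l

  basis-≡ : ∀ i l p → basis K R (inner i) l i p ≈ 𝟙 (does (labelAt R i p Fin.≟ l))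
  basis-≡ i l p with i Fin.≟ i
  ... | yes _  = refl
  ... | no i≢i = contradiction ≡.refl i≢i

  basis-≢ : ∀ {i} l {j} p → i ≢ j → basis K R (inner i) l j p ≈ 0#
  basis-≢ {i} l {j} p i≢j with i Fin.≟ j
  ... | yes i≡j = contradiction i≡j i≢j
  ... | no  _   = refl

  α-labelAt : ∀ a i p → α a (inner i) (labelAt R i p) ≈ a i p
  α-labelAt a i p = begin
    α a (inner i) l
      ≈⟨ sum-single i (λ j j≢i → sum-zero {indeg G (inner j)} λ q →
           trans (*-congˡ (basis-≢ l q (j≢i ∘ ≡.sym))) (zeroʳ (a j q))) ⟩
    sum (λ q → a i q * basis K R (inner i) l i q)
      ≈⟨ (sum-cong λ q → *-congˡ (basis-≡ i l q)) ⟩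
    sum (λ q → a i q * 𝟙 (does (labelAt R i q Fin.≟ l)))
      ≈⟨ sum-single p (λ q q≢p → trans (*-congˡ (𝟙-no (labelAt R i q Fin.≟ l) (q≢p ∘ labelAt-injective)))
                                        (zeroʳ (a i q))) ⟩
    a i p * 𝟙 (does (l Fin.≟ l))
      ≈⟨ trans (*-congˡ (𝟙-yes (l Fin.≟ l) ≡.refl)) (*-identityʳ (a i p)) ⟩
    a i p ∎
    where l = labelAt R i p

  α-source : ∀ a l → α a source l ≈ 0#
  α-source a l = ·-zeroʳ a

  α-sink : ∀ a l → α a sink l ≈ 0#
  α-sink a l = ·-zeroʳ a

  -- The coefficients of the functional `a` pulled back along `φ`.
  weight : V K G → Fin m → Carrier
  weight a e = α a (tgt e) (label e) - α a (src e) (label e)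

  ·-φ : ∀ a x → a · φ K R x ≈ sum (λ e → x e * weight a e)
  ·-φ a x = trans (·-∑ a x (λ e i p → basis K R (tgt e) (label e) i p - basis K R (src e) (label e) i p))
    (sum-cong λ e → *-congˡ (·-- a (basis K R (tgt e) (label e)) (basis K R (src e) (label e))))

  ∑ᴸ : (Fin m → Carrier) → List (Fin m) → Carrier
  ∑ᴸ f []      = 0#
  ∑ᴸ f (e ∷ p) = f e + ∑ᴸ f p

  ∑ᴸ-++ : ∀ f p q → ∑ᴸ f (p ++ q) ≈ ∑ᴸ f p + ∑ᴸ f q
  ∑ᴸ-++ f []      q = sym (+-identityˡ (∑ᴸ f q))
  ∑ᴸ-++ f (e ∷ p) q = trans (+-congˡ (∑ᴸ-++ f p q)) (sym (+-assoc (f e) (∑ᴸ f p) (∑ᴸ f q)))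

  ∑ᴸ-cong : ∀ {f g} p → (∀ {e} → e ∈ p → f e ≈ g e) → ∑ᴸ f p ≈ ∑ᴸ g p
  ∑ᴸ-cong []      f≈g = refl
  ∑ᴸ-cong (e ∷ p) f≈g = +-cong (f≈g (here ≡.refl)) (∑ᴸ-cong p (f≈g ∘ there))

  telescope : ∀ (g : Vertex n → Carrier) {u v} p → IsPath G u p v →
              ∑ᴸ (λ e → g (tgt e) - g (src e)) p ≈ g v - g u
  telescope g []      ≡.refl = sym (-‿inverseʳ _)
  telescope g {u} {v} (e ∷ p) (≡.refl , path) = trans (+-congˡ (telescope g p path))
    (solve 3 (λ x y z → (x :- y) :+ (z :- x) := z :- y) refl (g (tgt e)) (g u) (g v))

  -- Counts occurrences; on a path, which repeats no edge, this is the indicator vector.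
  χ : List (Fin m) → Fin m → Carrier
  χ []      e = 0#
  χ (x ∷ p) e = 𝟙 (does (x Fin.≟ e)) + χ p e

  0≤χ : ∀ p e → 0# ≤ χ p e
  0≤χ []      e = ≤-refl
  0≤χ (x ∷ p) e = +-nonNeg (0≤𝟙 (does (x Fin.≟ e))) (0≤χ p e)

  χ-∉ : ∀ {p e} → e ∉ p → χ p e ≈ 0#
  χ-∉ {[]}    e∉ = refl
  χ-∉ {x ∷ p} {e} e∉ = trans (+-cong (𝟙-no (x Fin.≟ e) (e∉ ∘ here ∘ ≡.sym)) (χ-∉ (e∉ ∘ there))) (+-identityˡ 0#)

  χ-∈≉0 : ∀ {p e} → e ∈ p → ¬ χ p e ≈ 0#
  χ-∈≉0 {x ∷ p} {e} (here e≡x) χ≈0 = 0≉1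
    (trans (sym (+-nonNeg-zeroˡ (0≤𝟙 (does (x Fin.≟ e))) (0≤χ p e) χ≈0)) (𝟙-yes (x Fin.≟ e) (≡.sym e≡x)))
  χ-∈≉0 {x ∷ p} {e} (there e∈p) χ≈0 =
    χ-∈≉0 e∈p (+-nonNeg-zeroʳ (0≤𝟙 (does (x Fin.≟ e))) (0≤χ p e) χ≈0)

  χ-path-∈ : ∀ {u v p e} → IsPath G u p v → e ∈ p → χ p e ≈ 1#
  χ-path-∈ {p = x ∷ p} {e} (_ , path) (here ≡.refl) = trans
    (+-cong (𝟙-yes (x Fin.≟ e) ≡.refl) (χ-∉ λ e∈p → edge-irrefl {e} (proj₁ (edge-bounds path e∈p))))
    (+-identityʳ 1#)
  χ-path-∈ {p = x ∷ p} {e} (_ , path) (there e∈p) = trans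
    (+-cong (𝟙-no (x Fin.≟ e) λ { ≡.refl → edge-irrefl {e} (proj₁ (edge-bounds path e∈p)) }) (χ-path-∈ path e∈p))
    (+-identityˡ 1#)

  ∑-χ : ∀ f p → sum (λ e → χ p e * f e) ≈ ∑ᴸ f p
  ∑-χ f []      = sum-zero (λ e → zeroˡ (f e))
  ∑-χ f (x ∷ p) = begin
    sum (λ e → (𝟙 (does (x Fin.≟ e)) + χ p e) * f e)
      ≈⟨ (sum-cong λ e → distribʳ (f e) (𝟙 (does (x Fin.≟ e))) (χ p e)) ⟩
    sum (λ e → 𝟙 (does (x Fin.≟ e)) * f e + χ p e * f e)
      ≈⟨ ∑-distrib-+ (λ e → 𝟙 (does (x Fin.≟ e)) * f e) (λ e → χ p e * f e) ⟩
    sum (λ e → 𝟙 (does (x Fin.≟ e)) * f e) + sum (λ e → χ p e * f e)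
      ≈⟨ +-cong (sum-single x λ e e≢x → trans (*-congʳ (𝟙-no (x Fin.≟ e) (e≢x ∘ ≡.sym))) (zeroˡ (f e))) (∑-χ f p) ⟩
    𝟙 (does (x Fin.≟ x)) * f x + ∑ᴸ f p
      ≈⟨ +-congʳ (trans (*-congʳ (𝟙-yes (x Fin.≟ x) ≡.refl)) (*-identityˡ (f x))) ⟩
    f x + ∑ᴸ f p ∎

  atᵛ : Vertex n → Vertex n → Carrier
  atᵛ v u = 𝟙 (does (u ≟ v))

  inflow≈ : ∀ x v → inflow K G x v ≈ sum (λ e → x e * atᵛ v (tgt e))
  inflow≈ x v = sum-cong λ e → if≈*𝟙 (does (tgt e ≟ v)) (x e)

  outflow≈ : ∀ x v → outflow K G x v ≈ sum (λ e → x e * atᵛ v (src e))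
  outflow≈ x v = sum-cong λ e → if≈*𝟙 (does (src e ≟ v)) (x e)

  -- Writing the coefficients as differences of the function `atᵛ v` lets them telescope along
  -- paths.
  netflow : ∀ x v → inflow K G x v - outflow K G x v ≈ sum (λ e → x e * (atᵛ v (tgt e) - atᵛ v (src e)))
  netflow x v = begin
    inflow K G x v - outflow K G x v
      ≈⟨ +-cong (inflow≈ x v) (-‿cong (outflow≈ x v)) ⟩
    sum (λ e → x e * atᵛ v (tgt e)) - sum (λ e → x e * atᵛ v (src e))
      ≈⟨ sum-- (λ e → x e * atᵛ v (tgt e)) (λ e → x e * atᵛ v (src e)) ⟨
    sum (λ e → x e * atᵛ v (tgt e) - x e * atᵛ v (src e))
      ≈⟨ (sum-cong λ e → solve 3 (λ x s t → x :* s :- x :* t := x :* (s :- t)) refl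
                           (x e) (atᵛ v (tgt e)) (atᵛ v (src e))) ⟩
    sum (λ e → x e * (atᵛ v (tgt e) - atᵛ v (src e))) ∎

  inflow-source : ∀ x → inflow K G x source ≈ 0#
  inflow-source x = trans (inflow≈ x source)
    (sum-zero λ e → trans (*-congˡ (𝟙-no (tgt e ≟ source) (tgt≢source e))) (zeroʳ (x e)))

  netflow-χ : ∀ {u w p} v → IsPath G u p w → inflow K G (χ p) v - outflow K G (χ p) v ≈ atᵛ v w - atᵛ v u
  netflow-χ {p = p} v path = trans (netflow (χ p) v)
    (trans (∑-χ (λ e → atᵛ v (tgt e) - atᵛ v (src e)) p) (telescope (atᵛ v) p path))

  -- The net flow at `v` telescopes to `atᵛ v sink - atᵛ v source`. This is zero at inner vertices
  -- and minus one at the source, which has no inflow.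
  χ-flow : ∀ {p} → IsPath G source p sink → FlowPolytope K G (χ p)
  χ-flow {p} path = 0≤χ p , (λ i → x-y≈0⇒x≈y _ _ (trans (netflow-χ (inner i) path) (-‿inverseʳ 0#))) , (begin
    outflow K G (χ p) source
      ≈⟨ solve 2 (λ i o → o := i :- (i :- o)) refl (inflow K G (χ p) source) (outflow K G (χ p) source) ⟩
    inflow K G (χ p) source - (inflow K G (χ p) source - outflow K G (χ p) source)
      ≈⟨ +-cong (inflow-source (χ p)) (-‿cong (netflow-χ source path)) ⟩
    0# - (0# - 1#)
      ≈⟨ solve 2 (λ z o → z :- (z :- o) := o) refl 0# 1# ⟩
    1# ∎)

  ·-φχ : ∀ a p → a · φ K R (χ p) ≈ ∑ᴸ (weight a) p
  ·-φχ a p = trans (·-φ a (χ p)) (∑-χ (weight a) p)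

  -- While the label stays `l`, the weights are differences of the single function `λ v → α a v l`.
  ∑ᴸ-weight : ∀ a {u v l} p → IsPath G u p v → (∀ {e} → e ∈ p → label e ≡ l) →
              ∑ᴸ (weight a) p ≈ α a v l - α a u l
  ∑ᴸ-weight a {l = l} p path label≡l = trans
    (∑ᴸ-cong p λ {e} e∈p → reflexive (≡.cong (λ j → α a (tgt e) j - α a (src e) j) (label≡l e∈p)))
    (telescope (λ v → α a v l) p path)

  Q-φ : ∀ {x} → FlowPolytope K G x → Q K R (φ K R x)
  Q-φ flow = _ , flow , λ i p → refl

  ·-route : ∀ a l → a · φ K R (χ (Route.edges (route l))) ≈ 0#
  ·-route a l = begin
    a · φ K R (χ edges)           ≈⟨ ·-φχ a edges ⟩
    ∑ᴸ (weight a) edges           ≈⟨ ∑ᴸ-weight a edges (route-path l) label-unique ⟩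
    α a sink l - α a source l     ≈⟨ +-cong (α-sink a l) (-‿cong (α-source a l)) ⟩
    0# - 0#                       ≈⟨ x-0≈x 0# ⟩
    0#                            ∎
    where edges = Route.edges (route l)

  0∈Q : UniqueSink G → Q K R (λ _ _ → 0#)
  0∈Q unique-sink with Fin.any? (λ e → src e ≟ source)
  ... | no  no-edge = case Equivalence.to (unique-sink source) (λ e eq → no-edge (e , eq)) of λ ()
  -- Any route of the decomposition is mapped to the origin; its coordinates are checked by pairing
  -- with unit vectors.
  ... | yes (e , _) = χ (routeOf e) , χ-flow (route-path (label e)) , λ i p →
    trans (sym (unit-· i p (φ K R (χ (routeOf e))))) (·-route (unit (i , p)) (label e))

  -- The image of the route that reaches `i` on the route of slot `p` and continues on that of slot
  -- `q`. By `·-switch` it acts as the difference of the basis vectors at `p` and `q`.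
  switch : ∀ i (p q : Fin (indeg G (inner i))) → V K G
  switch i p q = φ K R (χ (Branches.into (branches i p) ++ Branches.out (branches i q)))

  switch∈Q : ∀ i p q → Q K R (switch i p q)
  switch∈Q i p q = Q-φ (χ-flow (path-++ _ (Branches.path-into (branches i p)) (Branches.path-out (branches i q))))

  -- Each half has a constant label, so its weights telescope; the ends at source and sink
  -- contribute zero.
  ·-switch : ∀ a i p q → a · switch i p q ≈ a i p - a i q
  ·-switch a i p q = begin
    a · switch i p q
      ≈⟨ ·-φχ a (P.into ++ S.out) ⟩
    ∑ᴸ (weight a) (P.into ++ S.out)
      ≈⟨ ∑ᴸ-++ (weight a) P.into S.out ⟩
    ∑ᴸ (weight a) P.into + ∑ᴸ (weight a) S.out
      ≈⟨ +-cong (∑ᴸ-weight a P.into P.path-into λ e∈ → label-unique (≡.subst (_ ∈_) P.split-at (∈.∈-++⁺ˡ e∈)))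
                (∑ᴸ-weight a S.out S.path-out λ e∈ → label-unique (≡.subst (_ ∈_) S.split-at (∈.∈-++⁺ʳ S.into e∈))) ⟩
    (α a (inner i) (labelAt R i p) - α a source (labelAt R i p)) + (α a sink (labelAt R i q) - α a (inner i) (labelAt R i q))
      ≈⟨ +-cong (+-cong (α-labelAt a i p) (-‿cong (α-source a (labelAt R i p)))) (+-cong (α-sink a (labelAt R i q)) (-‿cong (α-labelAt a i q))) ⟩
    (a i p - 0#) + (0# - a i q)
      ≈⟨ solve 3 (λ x y z → (x :- z) :+ (z :- y) := x :- y) refl (a i p) (a i q) 0# ⟩
    a i p - a i q ∎
    where
    module P = Branches (branches i p)
    module S = Branches (branches i q)

  private
    ones : Fin n → V K G
    ones i j p = 𝟙 (does (j Fin.≟ i))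

    ones-· : ∀ i x → ones i · x ≈ sum (x i)
    ones-· i x = trans (sum-single i λ j j≢i → sum-zero {indeg G (inner j)} λ p →
                         trans (*-congʳ (𝟙-no (j Fin.≟ i) j≢i)) (zeroˡ (x j p)))
                       (sum-cong λ p → trans (*-congʳ (𝟙-yes (i Fin.≟ i) ≡.refl)) (*-identityˡ (x i p)))

    -- Both ends of an edge satisfy the slot condition for its label, so the weights of `ones i` are
    -- the coefficients of the net flow into `i`.
    α-ones : ∀ i v l → (∀ {j} → v ≡ inner j → ∃[ p ] labelAt R j p ≡ l) → α (ones i) v l ≈ atᵛ (inner i) v
    α-ones i source    l slot = α-source (ones i) l
    α-ones i (inner j) l slot with slot ≡.refl
    ... | p , ≡.refl = trans (α-labelAt (ones i) j p)
      (𝟙-cong (j Fin.≟ i) (inner j ≟ inner i) (≡.cong inner) λ { ≡.refl → ≡.refl })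
    α-ones i sink      l slot = α-sink (ones i) l

  -- The coordinate sum at `i` is the net flow into `i`, which is zero by conservation.
  Q⊆ZeroSums : Q K R ⊆ ZeroSums K G
  Q⊆ZeroSums {y} (x , (_ , conserved , _) , φx≈y) i = begin
    sum (y i)
      ≈⟨ (sum-cong λ p → φx≈y i p) ⟨
    sum (φ K R x i)
      ≈⟨ ones-· i (φ K R x) ⟨
    ones i · φ K R x
      ≈⟨ ·-φ (ones i) x ⟩
    sum (λ e → x e * weight (ones i) e)
      ≈⟨ (sum-cong λ e → *-congˡ (+-cong (α-ones i (tgt e) (label e) slot-in)
                                            (-‿cong (α-ones i (src e) (label e) slot-out)))) ⟩
    sum (λ e → x e * (atᵛ (inner i) (tgt e) - atᵛ (inner i) (src e)))
      ≈⟨ netflow x (inner i) ⟨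
    inflow K G x (inner i) - outflow K G x (inner i)
      ≈⟨ +-congʳ (conserved i) ⟩
    outflow K G x (inner i) - outflow K G x (inner i)
      ≈⟨ -‿inverseʳ _ ⟩
    0# ∎

  ·-flow : ∀ a {y} → ((x , _) : Q K R y) → a · y ≈ sum (λ e → x e * weight a e)
  ·-flow a (x , _ , φx≈y) = trans (·-congˡ {a = a} λ i p → sym (φx≈y i p)) (·-φ a x)

  -- The half-space of a transversal

  module _ (M : Transversal R) where
    open Transversal M
    open DecMembership (Fin._≟_ {k}) using (_∈?_)

    early? : ∀ l v → Dec (Early M l v)
    early? l v = rank v ℕ.≤? rank (src (pick l))

    leftNormal : V K G
    leftNormal i p = sum λ j → 𝟙 (does (labelAt R i p ∈? inlevel R (left R M j) i))

    leftSum≈ : ∀ y → leftSum K R M y ≈ leftNormal · y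
    leftSum≈ y = sum-cong λ i → begin
      sum (λ j → sum λ p → if does (labelAt R i p ∈? inlevel R (left R M j) i) then y i p else 0#)
        ≈⟨ ∑-comm (λ j p → if does (labelAt R i p ∈? inlevel R (left R M j) i) then y i p else 0#) ⟩
      sum (λ p → sum λ j → if does (labelAt R i p ∈? inlevel R (left R M j) i) then y i p else 0#)
        ≈⟨ (sum-cong λ p → trans
             (sum-cong λ j → trans (if≈*𝟙 (does (labelAt R i p ∈? inlevel R (left R M j) i)) (y i p)) (*-comm _ _))
             (sym (*-distribʳ-sum (y i p) (λ j → 𝟙 (does (labelAt R i p ∈? inlevel R (left R M j) i)))))) ⟩
      sum (λ p → leftNormal i p * y i p) ∎

    -- In the sum over all routes only the one labelled `labelAt R i p` can contribute, so each
    -- coefficient is 0 or 1.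
    leftNormal≈ : ∀ i p → leftNormal i p ≈ 𝟙 (does (early? (labelAt R i p) (inner i)))
    leftNormal≈ i p = trans
      (sum-single (labelAt R i p) λ j j≢ →
        𝟙-no (labelAt R i p ∈? inlevel R (left R M j) i) (j≢ ∘ proj₁ ∘ ∈-inlevel-left M))
      (𝟙-cong (labelAt R i p ∈? inlevel R (left R M (labelAt R i p)) i) (early? (labelAt R i p) (inner i))
        (proj₂ ∘ ∈-inlevel-left M) (inlevel-left-∈ M i p))

    private
      α-inner : ∀ {i l} → ∃[ p ] labelAt R i p ≡ l → α leftNormal (inner i) l ≈ 𝟙 (does (early? l (inner i)))
      α-inner {i} (p , ≡.refl) = trans (α-labelAt leftNormal i p) (leftNormal≈ i p)

      α-tgt : ∀ e → α leftNormal (tgt e) (label e) ≈ 𝟙 (does (early? (label e) (tgt e)))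
      α-tgt e with tgt e in eq
      ... | source  = contradiction eq (tgt≢source e)
      ... | inner i = α-inner (slot-in eq)
      -- The sink is never early: a picked edge starts strictly before its target, hence before the
      -- sink.
      ... | sink    = trans (α-sink leftNormal (label e)) (sym (𝟙-no (early? (label e) sink) λ le →
        ℕ.<⇒≱ (ordered q) (ℕ.≤-trans (rank≤sink (tgt q)) le)))
        where q = pick (label e)

      -- The source is early for every label although `α` is zero there; the last term corrects
      -- this.
      α-src : ∀ e → α leftNormal (src e) (label e) ≈ 𝟙 (does (early? (label e) (src e))) - atᵛ source (src e)
      α-src e with src e in eq
      ... | source  = trans (α-source leftNormal (label e)) (sym (-‿inverseʳ 1#))
      ... | inner i = trans (α-inner (slot-out eq)) (sym (x-0≈x _))
      ... | sink    = contradiction eq (src≢sink e)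

      -- Along a route, vertices are early up to the start of the picked edge and no longer from its
      -- end on, so the indicator drops exactly across that edge.
      picked-early : ∀ e → 𝟙 (does (early? (label e) (src e))) - 𝟙 (does (early? (label e) (tgt e)))
                           ≈ 𝟙 (does (picked? M e))
      picked-early e with path-order (route-path (label e)) (∈-routeOf e) (pick∈R (label e))
      ... | inj₁ e≡q = trans (+-cong
        (𝟙-yes (early? (label e) (src e)) (ℕ.≤-reflexive (≡.cong (rank ∘ src) e≡q)))
        (-‿cong (𝟙-no (early? (label e) (tgt e)) λ le →
          edge-irrefl {e} (ℕ.≤-trans le (ℕ.≤-reflexive (≡.cong (rank ∘ src) (≡.sym e≡q)))))))
        (trans (x-0≈x 1#) (sym (𝟙-yes (picked? M e) e≡q)))
      ... | inj₂ (inj₁ tgt≤) = trans (+-cong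
        (𝟙-yes (early? (label e) (src e)) (ℕ.≤-trans (ℕ.<⇒≤ (ordered e)) tgt≤))
        (-‿cong (𝟙-yes (early? (label e) (tgt e)) tgt≤)))
        (trans (-‿inverseʳ 1#) (sym (𝟙-no (picked? M e) λ e≡q →
          edge-irrefl {e} (≡.subst (λ q → rank (tgt e) ℕ.≤ rank (src q)) (≡.sym e≡q) tgt≤))))
      ... | inj₂ (inj₂ ≤src) = trans (+-cong
        (𝟙-no (early? (label e) (src e)) late)
        (-‿cong (𝟙-no (early? (label e) (tgt e)) (late ∘ ℕ.≤-trans (ℕ.<⇒≤ (ordered e))))))
        (trans (x-0≈x 0#) (sym (𝟙-no (picked? M e) λ e≡q →
          edge-irrefl {e} (≡.subst (λ q → rank (tgt q) ℕ.≤ rank (src e)) (≡.sym e≡q) ≤src))))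
        where
        late : ¬ Early M (label e) (src e)
        late le = edge-irrefl {pick (label e)} (ℕ.≤-trans ≤src le)

    weight-leftNormal : ∀ e → weight leftNormal e ≈ atᵛ source (src e) - 𝟙 (does (picked? M e))
    weight-leftNormal e = begin
      weight leftNormal e
        ≈⟨ +-cong (α-tgt e) (-‿cong (α-src e)) ⟩
      t - (s - o)
        ≈⟨ solve 3 (λ t s o → t :- (s :- o) := o :- (s :- t)) refl t s o ⟩
      o - (s - t)
        ≈⟨ +-congˡ (-‿cong (picked-early e)) ⟩
      o - 𝟙 (does (picked? M e)) ∎
      where
      t = 𝟙 (does (early? (label e) (tgt e)))
      s = 𝟙 (does (early? (label e) (src e)))
      o = atᵛ source (src e)

    pickedFlow : (Fin m → Carrier) → Carrier
    pickedFlow x = sum λ e → x e * 𝟙 (does (picked? M e))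

    -- The edges leaving the source contribute the total flow 1. Nonnegativity of the flow on `M`
    -- then gives the half-space, with equality only if that flow vanishes.
    leftSum-flow : ∀ {y} → ((x , _) : Q K R y) → leftSum K R M y ≈ 1# - pickedFlow x
    leftSum-flow {y} q@(x , (_ , _ , unit-flow) , _) = begin
      leftSum K R M y
        ≈⟨ leftSum≈ y ⟩
      leftNormal · y
        ≈⟨ ·-flow leftNormal q ⟩
      sum (λ e → x e * weight leftNormal e)
        ≈⟨ (sum-cong λ e → trans (*-congˡ (weight-leftNormal e))
              (solve 3 (λ x s t → x :* (s :- t) := x :* s :- x :* t) refl
                 (x e) (atᵛ source (src e)) (𝟙 (does (picked? M e))))) ⟩
      sum (λ e → x e * atᵛ source (src e) - x e * 𝟙 (does (picked? M e)))
        ≈⟨ sum-- (λ e → x e * atᵛ source (src e)) (λ e → x e * 𝟙 (does (picked? M e))) ⟩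
      sum (λ e → x e * atᵛ source (src e)) - pickedFlow x
        ≈⟨ +-congʳ (trans (sym (outflow≈ x source)) unit-flow) ⟩
      1# - pickedFlow x ∎

    pickedFlow-nonNeg : ∀ {x} → FlowPolytope K G x → ∀ e → 0# ≤ x e * 𝟙 (does (picked? M e))
    pickedFlow-nonNeg (0≤x , _) e = *-nonNeg (0≤x e) (0≤𝟙 (does (picked? M e)))

    Q⊆HalfSpace : Q K R ⊆ HalfSpace K R M
    Q⊆HalfSpace q@(x , flow , _) = ≤-respˡ-≈ (sym (leftSum-flow q)) (0≤y-x⇒x≤y (≤-respʳ-≈
      (solve 2 (λ o s → s := o :- (o :- s)) refl 1# (pickedFlow x)) (sum-nonNeg (pickedFlow-nonNeg flow))))

    H⇒unpicked : ∀ {y} → ((x , _) : Q K R y) → H K R M y → ∀ e → Picked M e → x e ≈ 0#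
    H⇒unpicked {y} q@(x , flow , _) y∈H e picked = begin
      x e                             ≈⟨ *-identityʳ (x e) ⟨
      x e * 1#                        ≈⟨ *-congˡ (𝟙-yes (picked? M e) picked) ⟨
      x e * 𝟙 (does (picked? M e))    ≈⟨ sum-nonNeg-zero (pickedFlow-nonNeg flow) pickedFlow≈0 e ⟩
      0#                              ∎
      where
      pickedFlow≈0 : pickedFlow x ≈ 0#
      pickedFlow≈0 = begin
        pickedFlow x                ≈⟨ solve 2 (λ o s → s := o :- (o :- s)) refl 1# (pickedFlow x) ⟩
        1# - (1# - pickedFlow x)    ≈⟨ +-congˡ (-‿cong (trans (sym (leftSum-flow q)) y∈H)) ⟩
        1# - 1#                     ≈⟨ -‿inverseʳ 1# ⟩
        0#                          ∎

    unpicked⇒H : ∀ {y} → ((x , _) : Q K R y) → (∀ e → Picked M e → x e ≈ 0#) → H K R M y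
    unpicked⇒H q@(x , _) x≈0 = trans (leftSum-flow q) (trans (+-congˡ (-‿cong (sum-zero λ e → at e (picked? M e))))
                                                             (x-0≈x 1#))
      where
      at : ∀ e (d : Dec (Picked M e)) → x e * 𝟙 (does d) ≈ 0#
      at e (yes picked) = trans (*-identityʳ (x e)) (x≈0 e picked)
      at e (no _)       = zeroʳ (x e)

-- Coverable transversals and the routes avoiding them

module Coverings {c ℓ₁ ℓ₂} (K : OrderedField c ℓ₁ ℓ₂) {n m k} {G : Graph n m} (R : RouteDecomposition G k)
  (M : Transversal R) where
  open Flows K R
  open Graph G
  open RouteDecomposition R
  open Transversal M

  UnpickedPath : Vertex n → Vertex n → Set
  UnpickedPath u v = Σ[ p ∈ List (Fin m) ] (IsPath G u p v × (∀ {e} → e ∈ p → ¬ Picked M e))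

  nil : ∀ {v} → UnpickedPath v v
  nil = [] , ≡.refl , λ ()

  edge : ∀ {e} → ¬ Picked M e → UnpickedPath (src e) (tgt e)
  edge {e} ¬picked = e ∷ [] , (≡.refl , ≡.refl) , λ { (here ≡.refl) → ¬picked }

  infixr 5 _⊹_
  _⊹_ : ∀ {u v w} → UnpickedPath u v → UnpickedPath v w → UnpickedPath u w
  (p , path-p , ¬p) ⊹ (q , path-q , ¬q) = p ++ q , path-++ p path-p path-q , λ e∈ →
    [ (λ e∈p → ¬p e∈p) , (λ e∈q → ¬q e∈q) ]′ (∈.∈-++⁻ p e∈)

  unpickedPoint : UnpickedPath source sink → V K G
  unpickedPoint (p , _) = φ K R (χ p)

  unpickedPoint∈Q : ∀ P → Q K R (unpickedPoint P)
  unpickedPoint∈Q (p , path , _) = Q-φ (χ-flow path)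

  unpickedPoint∈H : ∀ P → H K R M (unpickedPoint P)
  unpickedPoint∈H P@(_ , _ , unpicked) = unpicked⇒H M (unpickedPoint∈Q P) λ e picked →
    χ-∉ λ e∈p → unpicked e∈p picked

  record Covered (i : Fin n) : Set where
    field
      into : UnpickedPath source (inner i)
      out  : UnpickedPath (inner i) sink

  coverable⇒covered : Coverable R M → ∀ i → Covered i
  coverable⇒covered cov i with cov i
  ... | P , (e , e∈P , incident) , avoids = record
    { into = into incident ; out = out incident }
    where
    open Route P
    open Split (split isPath e∈P)
    unpicked : ∀ {x} → x ∈ edges → ¬ Picked M x
    unpicked {x} x∈P picked = avoids (label x) (≡.subst (_∈ edges) picked x∈P)
    before-e : UnpickedPath source (src e)
    before-e = before , path-before , λ x∈ → unpicked (≡.subst (_ ∈_) (≡.sym ≡-++) (∈.∈-++⁺ˡ x∈))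
    after-e : UnpickedPath (tgt e) sink
    after-e = after , path-after , λ x∈ → unpicked (≡.subst (_ ∈_) (≡.sym ≡-++) (∈.∈-++⁺ʳ before (there x∈)))
    into : src e ≡ inner i ⊎ tgt e ≡ inner i → UnpickedPath source (inner i)
    into (inj₁ src≡) = ≡.subst (UnpickedPath source) src≡ before-e
    into (inj₂ tgt≡) = ≡.subst (UnpickedPath source) tgt≡ (before-e ⊹ edge (unpicked e∈P))
    out : src e ≡ inner i ⊎ tgt e ≡ inner i → UnpickedPath (inner i) sink
    out (inj₁ src≡) = ≡.subst (λ v → UnpickedPath v sink) src≡ (edge (unpicked e∈P) ⊹ after-e)
    out (inj₂ tgt≡) = ≡.subst (λ v → UnpickedPath v sink) tgt≡ after-e

  covered⇒coverable : (∀ i → Covered i) → Coverable R M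
  covered⇒coverable covered i = record { edges = p ; isPath = path } , incident , avoids
    where
    open Covered (covered i)
    P : UnpickedPath source sink
    P = into ⊹ out
    p = proj₁ P
    path = proj₁ (proj₂ P)
    incident : ∃[ e ] (e ∈ p × (src e ≡ inner i ⊎ tgt e ≡ inner i))
    -- The second half is nonempty because `inner i` is not `sink`; its first edge leaves `i`.
    incident with out
    ... | e ∷ _ , (src≡ , _) , _ = e , ∈.∈-++⁺ʳ (proj₁ into) (here ≡.refl) , inj₁ src≡
    avoids : ∀ j → pick j ∉ p
    avoids j j∈p = proj₂ (proj₂ P) j∈p (picked-pick M j)

  -- Walk backwards along unpicked entrances to the source and forwards along unpicked exits to the
  -- sink; ranks ensure that both walks end.
  locally⇒covered : (∀ i → ∃[ e ] (tgt e ≡ inner i × ¬ Picked M e)) →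
                    (∀ i → ∃[ e ] (src e ≡ inner i × ¬ Picked M e)) → ∀ i → Covered i
  locally⇒covered entrance exit i = record
    { into = into (rank (inner i)) (inner i) ℕ.≤-refl (λ ())
    ; out  = out (suc n) (inner i) (ℕ.m≤m+n (suc n) (rank (inner i))) (λ ())
    }
    where
    -- The recursion is on `f`, which bounds the rank still to descend; in `out` it bounds the rank
    -- still to climb.
    into : ∀ f v → rank v ℕ.≤ f → v ≢ sink → UnpickedPath source v
    into f       source    _       _     = nil
    into f       sink      _       ≢sink = contradiction ≡.refl ≢sink
    into (suc f) (inner i) (ℕ.s≤s le) _  with entrance i
    ... | e , tgt≡ , ¬picked = ≡.subst (UnpickedPath source) tgt≡
      (into f (src e) (ℕ.≤-trans (ℕ.s≤s⁻¹ (≡.subst (λ v → rank (src e) ℕ.< rank v) tgt≡ (ordered e))) le) (src≢sink e)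
        ⊹ edge ¬picked)
    out : ∀ f v → suc n ℕ.≤ f ℕ.+ rank v → v ≢ source → UnpickedPath v sink
    out f       sink      _  _       = nil
    out f       source    _  ≢source = contradiction ≡.refl ≢source
    out zero    (inner i) le _       = contradiction (ℕ.s≤s⁻¹ le) (ℕ.<⇒≱ (Fin.toℕ<n i))
    out (suc f) (inner i) le _       with exit i
    ... | e , src≡ , ¬picked = ≡.subst (λ v → UnpickedPath v sink) src≡
      (edge ¬picked ⊹ out f (tgt e) (ℕ.≤-trans le (ℕ.≤-trans (ℕ.≤-reflexive (≡.sym (ℕ.+-suc f (rank (inner i)))))
         (ℕ.+-monoʳ-≤ f (≡.subst (λ v → rank v ℕ.< rank (tgt e)) src≡ (ordered e))))) (tgt≢source e))

  module _ (covered : ∀ i → Covered i) where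

    into : ∀ v → v ≢ sink → UnpickedPath source v
    into source    _     = nil
    into (inner i) _     = Covered.into (covered i)
    into sink      ≢sink = contradiction ≡.refl ≢sink

    out : ∀ v → v ≢ source → UnpickedPath v sink
    out source    ≢source = contradiction ≡.refl ≢source
    out (inner i) _       = Covered.out (covered i)
    out sink      _       = nil

    through : ∀ e → ¬ Picked M e → UnpickedPath source sink
    through e ¬picked = into (src e) (src≢sink e) ⊹ edge ¬picked ⊹ out (tgt e) (tgt≢source e)

    visit : Fin n → UnpickedPath source sink
    visit i = Covered.into (covered i) ⊹ Covered.out (covered i)

    ∈-through : ∀ e (¬picked : ¬ Picked M e) → e ∈ proj₁ (through e ¬picked)
    ∈-through e ¬picked = ∈.∈-++⁺ʳ (proj₁ (into (src e) (src≢sink e))) (here ≡.refl)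

    -- If a vanishes on all these routes then, off M, its weights are differences
    -- of a potential π. Propagating α a - π from the end of a route of R on
    -- whose side of vertex i it does not meet M shows that a is constant at i.
    module Potential (a : V K G)
      (visit≈0   : ∀ i → ∑ᴸ (weight a) (proj₁ (visit i)) ≈ 0#)
      (through≈0 : ∀ e ¬picked → ∑ᴸ (weight a) (proj₁ (through e ¬picked)) ≈ 0#) where

      -- The weights of the chosen paths from the source and to the sink. Vanishing on `visit` makes
      -- `ρ` the negative of `π`.
      π ρ : Vertex n → Carrier
      π source    = 0#
      π (inner i) = ∑ᴸ (weight a) (proj₁ (Covered.into (covered i)))
      π sink      = 0#
      ρ source    = 0#
      ρ (inner i) = ∑ᴸ (weight a) (proj₁ (Covered.out (covered i)))
      ρ sink      = 0#

      -- Constant along stretches of route `l` that miss `M`, and zero at both ends of the route.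
      β : Fin k → Vertex n → Carrier
      β l v = α a v l - π v

      private
        into≈π : ∀ v ≢sink → ∑ᴸ (weight a) (proj₁ (into v ≢sink)) ≈ π v
        into≈π source    _     = refl
        into≈π (inner i) _     = refl
        into≈π sink      ≢sink = contradiction ≡.refl ≢sink

        out≈ρ : ∀ v ≢source → ∑ᴸ (weight a) (proj₁ (out v ≢source)) ≈ ρ v
        out≈ρ source    ≢source = contradiction ≡.refl ≢source
        out≈ρ (inner i) _       = refl
        out≈ρ sink      _       = refl

        π+ρ≈0 : ∀ v → π v + ρ v ≈ 0#
        π+ρ≈0 source    = +-identityˡ 0#
        π+ρ≈0 (inner i) = trans (sym (∑ᴸ-++ (weight a) (proj₁ (Covered.into (covered i))) _)) (visit≈0 i)
        π+ρ≈0 sink      = +-identityˡ 0#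

        weight≈ : ∀ e → ¬ Picked M e → π (src e) + (weight a e + ρ (tgt e)) ≈ 0#
        weight≈ e ¬picked = begin
          π (src e) + (weight a e + ρ (tgt e))
            ≈⟨ +-cong (into≈π (src e) (src≢sink e)) (+-congˡ (out≈ρ (tgt e) (tgt≢source e))) ⟨
          ∑ᴸ (weight a) p + (weight a e + ∑ᴸ (weight a) q)
            ≈⟨ ∑ᴸ-++ (weight a) p (e ∷ q) ⟨
          ∑ᴸ (weight a) (p ++ e ∷ q)
            ≈⟨ through≈0 e ¬picked ⟩
          0# ∎
          where
          p = proj₁ (into (src e) (src≢sink e))
          q = proj₁ (out (tgt e) (tgt≢source e))

        β-step : ∀ {e l} → label e ≡ l → ¬ Picked M e → β l (tgt e) - β l (src e) ≈ 0#
        β-step {e} ≡.refl ¬picked = begin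
          (t - π (tgt e)) - (s - π (src e))
            ≈⟨ solve 5 (λ t s p q r → (t :- q) :- (s :- p) := (p :+ ((t :- s) :+ r)) :- (q :+ r)) refl
                 t s (π (src e)) (π (tgt e)) (ρ (tgt e)) ⟩
          (π (src e) + (weight a e + ρ (tgt e))) - (π (tgt e) + ρ (tgt e))
            ≈⟨ +-cong (weight≈ e ¬picked) (-‿cong (π+ρ≈0 (tgt e))) ⟩
          0# - 0#
            ≈⟨ x-0≈x 0# ⟩
          0# ∎
          where
          t = α a (tgt e) (label e)
          s = α a (src e) (label e)

        β-path : ∀ {u v l} p → IsPath G u p v → (∀ {e} → e ∈ p → label e ≡ l) → (∀ {e} → e ∈ p → ¬ Picked M e) →
                 β l v ≈ β l u
        β-path {u} {v} {l} p path label≡l unpicked = x-y≈0⇒x≈y (β l v) (β l u) (trans (sym (telescope (β l) p path))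
          (trans (∑ᴸ-cong p λ e∈p → β-step (label≡l e∈p) (unpicked e∈p)) (∑ᴸ-zero p)))
          where
          ∑ᴸ-zero : ∀ p → ∑ᴸ (λ _ → 0#) p ≈ 0#
          ∑ᴸ-zero []      = refl
          ∑ᴸ-zero (_ ∷ p) = trans (+-identityˡ _) (∑ᴸ-zero p)

        β-source : ∀ l → β l source ≈ 0#
        β-source l = trans (x-0≈x _) (α-source a l)

        β-sink : ∀ l → β l sink ≈ 0#
        β-sink l = trans (x-0≈x _) (α-sink a l)

      a≈π : ∀ i p → a i p ≈ π (inner i)
      a≈π i p = trans (sym (α-labelAt a i p)) (x-y≈0⇒x≈y _ _ β≈0)
        where
        open Branches (branches i p) renaming (into to R-into; out to R-out)
        l = labelAt R i p
        label-into : ∀ {e} → e ∈ R-into → label e ≡ l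
        label-into e∈ = label-unique (≡.subst (_ ∈_) split-at (∈.∈-++⁺ˡ e∈))
        label-out : ∀ {e} → e ∈ R-out → label e ≡ l
        label-out e∈ = label-unique (≡.subst (_ ∈_) split-at (∈.∈-++⁺ʳ R-into e∈))
        disjoint : ∀ {e} → e ∈ R-into → e ∈ R-out → ⊥
        disjoint {e} e∈into e∈out = edge-irrefl {e}
          (ℕ.≤-trans (proj₂ (edge-bounds path-into e∈into)) (proj₁ (edge-bounds path-out e∈out)))
        β≈0 : β l (inner i) ≈ 0#
        -- If the picked edge of `l` comes before `i`, compare with the sink; if it comes after,
        -- compare with the source.
        β≈0 with ∈.∈-++⁻ R-into (≡.subst (pick l ∈_) (≡.sym split-at) (pick∈R l))
        ... | inj₁ q∈into = trans (sym (β-path R-out path-out label-out λ {e} e∈ picked →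
                disjoint q∈into (≡.subst (_∈ R-out) (≡.trans picked (≡.cong pick (label-out e∈))) e∈))) (β-sink l)
        ... | inj₂ q∈out  = trans (β-path R-into path-into label-into λ {e} e∈ picked →
                disjoint (≡.subst (_∈ R-into) (≡.trans picked (≡.cong pick (label-into e∈))) e∈) q∈out) (β-source l)

    separated : ∀ {a} P → ¬ ∑ᴸ (weight a) (proj₁ P) ≈ 0# → ∃[ z ] ((Q K R ∩ H K R M) z × ¬ a · z ≈ 0#)
    separated {a} P ≉0 = unpickedPoint P , (unpickedPoint∈Q P , unpickedPoint∈H P) , ≉0 ∘ trans (sym (·-φχ a (proj₁ P)))

    -- The edge list of `through e` does not depend on the proof that `e` is unpicked, so testing
    -- one proof decides for all.
    through? : ∀ a e → Dec (Σ[ ¬picked ∈ ¬ Picked M e ] ¬ ∑ᴸ (weight a) (proj₁ (through e ¬picked)) ≈ 0#)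
    through? a e with picked? M e
    ... | yes picked  = no λ (¬picked , _) → ¬picked picked
    ... | no  ¬picked with ∑ᴸ (weight a) (proj₁ (through e ¬picked)) ≈? 0#
    ...   | yes ≈0 = no λ (_ , ≉0) → ≉0 ≈0
    ...   | no  ≉0 = yes (¬picked , ≉0)

    -- Search the finitely many routes `visit` and `through`. If `a` vanished on all of them, it
    -- would be constant at `i`, yet it is zero at `q` and nonzero at `p`.
    separate : ∀ a {i} p q → a i q ≈ 0# → ¬ a i p ≈ 0# → ∃[ z ] ((Q K R ∩ H K R M) z × ¬ a · z ≈ 0#)
    separate a {i} p q aq≈0 ap≉0
      with Fin.any? (λ j → ¬? (∑ᴸ (weight a) (proj₁ (visit j)) ≈? 0#))
         | Fin.any? (through? a)
    ... | yes (j , ≉0)   | _ = separated (visit j) ≉0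
    ... | no  _          | yes (e , ¬picked , ≉0) = separated (through e ¬picked) ≉0
    ... | no all-visit≈0 | no all-through≈0 = contradiction (trans (a≈π i p) (trans (sym (a≈π i q)) aq≈0)) ap≉0
      where
      open Potential a
        (λ j → decidable-stable (∑ᴸ (weight a) (proj₁ (visit j)) ≈? 0#) λ ≉0 → all-visit≈0 (j , ≉0))
        (λ e ¬picked → decidable-stable (∑ᴸ (weight a) (proj₁ (through e ¬picked)) ≈? 0#) λ ≉0 →
          all-through≈0 (e , ¬picked , ≉0))

-- Affine combinations of flows and edges without flow

module Combinations {c ℓ₁ ℓ₂} (K : OrderedField c ℓ₁ ℓ₂) {n m k} {G : Graph n m} (R : RouteDecomposition G k) where
  open Flows K R
  open Graph G
  open RouteDecomposition R

  combination : Carrier → Carrier → (x y : Fin m → Carrier) → Fin m → Carrier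
  combination s t x y e = s * x e + t * y e

  sum-combination : ∀ s t x y (f : Fin m → Carrier) →
    sum (λ e → combination s t x y e * f e) ≈ s * sum (λ e → x e * f e) + t * sum (λ e → y e * f e)
  sum-combination s t x y f = begin
    sum (λ e → (s * x e + t * y e) * f e)
      ≈⟨ (sum-cong λ e → solve 5 (λ s t x y f → (s :* x :+ t :* y) :* f := s :* (x :* f) :+ t :* (y :* f)) refl
                           s t (x e) (y e) (f e)) ⟩
    sum (λ e → s * (x e * f e) + t * (y e * f e))
      ≈⟨ ∑-distrib-+ (λ e → s * (x e * f e)) (λ e → t * (y e * f e)) ⟩
    sum (λ e → s * (x e * f e)) + sum (λ e → t * (y e * f e))
      ≈⟨ +-cong (*-distribˡ-sum s (λ e → x e * f e)) (*-distribˡ-sum t (λ e → y e * f e)) ⟨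
    s * sum (λ e → x e * f e) + t * sum (λ e → y e * f e) ∎

  ·-combination : ∀ a s t x y →
    a · φ K R (combination s t x y) ≈ s * (a · φ K R x) + t * (a · φ K R y)
  ·-combination a s t x y = trans (·-φ a (combination s t x y)) (trans (sum-combination s t x y (weight a))
    (sym (+-cong (*-congˡ (·-φ a x)) (*-congˡ (·-φ a y)))))

  -- The coefficients may be negative, so nonnegativity is a hypothesis; this serves midpoints and
  -- extrapolations alike.
  combination-flow : ∀ {s t x y} → s + t ≈ 1# → FlowPolytope K G x → FlowPolytope K G y →
                     (∀ e → 0# ≤ combination s t x y e) → FlowPolytope K G (combination s t x y)
  combination-flow {s} {t} {x} {y} s+t≈1 (_ , conserved-x , unit-x) (_ , conserved-y , unit-y) nonNeg = nonNeg ,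
    (λ i → trans (in-comb (inner i)) (trans (+-cong (*-congˡ (conserved-x i)) (*-congˡ (conserved-y i)))
                                            (sym (out-comb (inner i))))) ,
    (begin
      outflow K G (combination s t x y) source                      ≈⟨ out-comb source ⟩
      s * outflow K G x source + t * outflow K G y source           ≈⟨ +-cong (*-congˡ unit-x) (*-congˡ unit-y) ⟩
      s * 1# + t * 1#                                               ≈⟨ +-cong (*-identityʳ s) (*-identityʳ t) ⟩
      s + t                                                         ≈⟨ s+t≈1 ⟩
      1#                                                            ∎)
    where
    in-comb : ∀ v → inflow K G (combination s t x y) v ≈ s * inflow K G x v + t * inflow K G y v
    in-comb v = trans (inflow≈ (combination s t x y) v) (trans (sum-combination s t x y (λ e → atᵛ v (tgt e)))
      (sym (+-cong (*-congˡ (inflow≈ x v)) (*-congˡ (inflow≈ y v)))))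
    out-comb : ∀ v → outflow K G (combination s t x y) v ≈ s * outflow K G x v + t * outflow K G y v
    out-comb v = trans (outflow≈ (combination s t x y) v) (trans (sum-combination s t x y (λ e → atᵛ v (src e)))
      (sym (+-cong (*-congˡ (outflow≈ x v)) (*-congˡ (outflow≈ y v)))))

  -- Both halves are nonnegative, so an edge with zero flow in the midpoint has zero flow in each.
  midpoint : ∀ a b x y → FlowPolytope K G x → a · φ K R x ≈ b → FlowPolytope K G y → a · φ K R y ≈ b →
             Σ[ z ∈ (Fin m → Carrier) ]
               (FlowPolytope K G z × a · φ K R z ≈ b × (∀ e → z e ≈ 0# → x e ≈ 0# × y e ≈ 0#))
  midpoint a b x y flow-x a·x≈b flow-y a·y≈b = combination h h x y , combination-flow h+h≈1 flow-x flow-y nonNeg ,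
    value , λ e ≈0 → *-cancel-zero h≉0 (+-nonNeg-zeroˡ (0≤hx e) (0≤hy e) ≈0) ,
                     *-cancel-zero h≉0 (+-nonNeg-zeroʳ (0≤hx e) (0≤hy e) ≈0)
    where
    h = proj₁ half
    h+h≈1 = proj₂ (proj₂ half)
    0≤hx : ∀ e → 0# ≤ h * x e
    0≤hx e = *-nonNeg (proj₁ (proj₂ half)) (proj₁ flow-x e)
    0≤hy : ∀ e → 0# ≤ h * y e
    0≤hy e = *-nonNeg (proj₁ (proj₂ half)) (proj₁ flow-y e)
    nonNeg : ∀ e → 0# ≤ combination h h x y e
    nonNeg e = +-nonNeg (0≤hx e) (0≤hy e)
    h≉0 : ¬ h ≈ 0#
    h≉0 h≈0 = 0≉1 (trans (sym (trans (+-cong h≈0 h≈0) (+-identityˡ 0#))) h+h≈1)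
    value : a · φ K R (combination h h x y) ≈ b
    value = begin
      a · φ K R (combination h h x y)              ≈⟨ ·-combination a h h x y ⟩
      h * (a · φ K R x) + h * (a · φ K R y)        ≈⟨ +-cong (*-congˡ a·x≈b) (*-congˡ a·y≈b) ⟩
      h * b + h * b                                ≈⟨ distribʳ b h h ⟨
      (h + h) * b                                  ≈⟨ *-congʳ h+h≈1 ⟩
      1# * b                                       ≈⟨ *-identityˡ b ⟩
      b                                            ∎

  -- Iterated midpoints replace the arithmetic mean: only the value of `a` and the edges without
  -- flow matter.
  average : ∀ a b {r} (x : Fin (suc r) → Fin m → Carrier) →
            (∀ j → FlowPolytope K G (x j)) → (∀ j → a · φ K R (x j) ≈ b) →
            Σ[ x̄ ∈ (Fin m → Carrier) ]
              (FlowPolytope K G x̄ × a · φ K R x̄ ≈ b × (∀ e → x̄ e ≈ 0# → ∀ j → x j e ≈ 0#))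
  average a b {zero}  x flow a·x≈b = x zero , flow zero , a·x≈b zero , λ { e x≈0 zero → x≈0 }
  average a b {suc r} x flow a·x≈b =
    let ȳ , flow-ȳ , a·ȳ≈b , zeros = average a b (x ∘ suc) (flow ∘ suc) (a·x≈b ∘ suc)
        x̄ , flow-x̄ , a·x̄≈b , both  = midpoint a b (x zero) ȳ (flow zero) (a·x≈b zero) flow-ȳ a·ȳ≈b
    in x̄ , flow-x̄ , a·x̄≈b , λ where
         e ≈0 zero    → proj₁ (both e ≈0)
         e ≈0 (suc j) → zeros e (proj₂ (both e ≈0)) j

  positive-lower-bound : ∀ (x : Fin m → Carrier) p → (∀ {e} → e ∈ p → 0# ≤ x e × ¬ x e ≈ 0#) →
                         ∃[ ε ] (0# ≤ ε × ¬ ε ≈ 0# × (∀ {e} → e ∈ p → ε ≤ x e))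
  positive-lower-bound x []      _   = 1# , 0≤1 , (λ 1≈0 → 0≉1 (sym 1≈0)) , λ ()
  positive-lower-bound x (e ∷ p) pos with positive-lower-bound x p (pos ∘ there)
  ... | ε , 0≤ε , ε≉0 , ε≤ with total ε (x e)
  ...   | inj₁ ε≤x = ε , 0≤ε , ε≉0 , λ { (here ≡.refl) → ε≤x ; (there e∈p) → ε≤ e∈p }
  ...   | inj₂ x≤ε = x e , proj₁ (pos (here ≡.refl)) , proj₂ (pos (here ≡.refl)) ,
    λ { (here ≡.refl) → ≤-refl ; (there e∈p) → ≤-trans x≤ε (ε≤ e∈p) }

  -- Otherwise the flow could be extrapolated away from the route l, which is
  -- mapped to 0, beyond the half-space a · y ≤ b.
  zero-on-route : ∀ a b → (∀ {y} → Q K R y → a · y ≤ b) → 0# ≤ b → ¬ b ≈ 0# →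
                  ∀ x → FlowPolytope K G x → a · φ K R x ≈ b → ∀ l → ∃[ e ] (label e ≡ l × x e ≈ 0#)
  zero-on-route a b bound 0≤b b≉0 x flow@(0≤x , _) a·x≈b l
    with Fin.any? (λ e → (label e Fin.≟ l) ×-dec (x e ≈? 0#))
  ... | yes found = found
  ... | no  none  with positive-lower-bound x (Route.edges (route l))
                         (λ {e} e∈ → 0≤x e , λ x≈0 → none (e , label-unique e∈ , x≈0))
  ...   | ε , 0≤ε , ε≉0 , ε≤ = contradiction (*-cancel-zero ε≉0 (antisym εb≤0 (*-nonNeg 0≤ε 0≤b))) b≉0
    where
    edges = Route.edges (route l)
    x′ : Fin m → Carrier
    -- The coefficients sum to 1, and the route contributes nothing under `φ`, so the value of `a`
    -- becomes `(1# + ε) * b`.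
    x′ = combination (1# + ε) (- ε) x (χ edges)
    nonNeg : ∀ e → 0# ≤ x′ e
    nonNeg e with label e Fin.≟ l
    -- On the route, `x′ e` equals `ε * x e + (x e - ε)`, and `ε` was chosen at most `x e`.
    ... | yes l≡ = ≤-respʳ-≈ (begin
        ε * x e + (x e - ε)                     ≈⟨ +-cong refl (+-cong (*-identityˡ (x e)) (-‿cong (*-identityʳ ε))) ⟨
        ε * x e + (1# * x e - ε * 1#)           ≈⟨ solve 3 (λ ε x o → ε :* x :+ (o :* x :- ε :* o)
                                                       := (o :+ ε) :* x :+ (:- ε) :* o) refl ε (x e) 1# ⟩
        (1# + ε) * x e + (- ε) * 1#             ≈⟨ +-congˡ (*-congˡ (χ-path-∈ (route-path l) (∈-route l≡))) ⟨
        x′ e                                    ∎)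
        (+-nonNeg (*-nonNeg 0≤ε (0≤x e)) (x≤y⇒0≤y-x (ε≤ (∈-route l≡))))
    ... | no  l≢ = ≤-respʳ-≈ (sym (trans (+-congˡ (trans (*-congˡ (χ-∉ (l≢ ∘ label-unique))) (zeroʳ (- ε))))
                                         (+-identityʳ _)))
        (*-nonNeg (+-nonNeg 0≤1 0≤ε) (0≤x e))
    flow′ : FlowPolytope K G x′
    flow′ = combination-flow (solve 2 (λ o ε → o :+ ε :+ (:- ε) := o) refl 1# ε) flow (χ-flow (route-path l)) nonNeg
    value : a · φ K R x′ ≈ b + ε * b
    value = begin
      a · φ K R x′                                                    ≈⟨ ·-combination a (1# + ε) (- ε) x (χ edges) ⟩
      (1# + ε) * (a · φ K R x) + (- ε) * (a · φ K R (χ edges))        ≈⟨ +-cong (*-congˡ a·x≈b) (*-congˡ (·-route a l)) ⟩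
      (1# + ε) * b + (- ε) * 0#                                       ≈⟨ +-cong (distribʳ b 1# ε) (zeroʳ (- ε)) ⟩
      (1# * b + ε * b) + 0#                                           ≈⟨ trans (+-identityʳ _) (+-congʳ (*-identityˡ b)) ⟩
      b + ε * b                                                       ∎
    εb≤0 : ε * b ≤ 0#
    εb≤0 = 0≤y-x⇒x≤y (≤-respʳ-≈ (trans (+-congˡ (-‿cong value))
      (trans (solve 2 (λ b t → b :- (b :+ t) := (b :- b) :- t) refl b (ε * b)) (+-congʳ (-‿inverseʳ b))))
      (x≤y⇒0≤y-x (bound (Q-φ flow′))))

  common-zero-on-route : ∀ a b → (∀ {y} → Q K R y → a · y ≤ b) → 0# ≤ b → ¬ b ≈ 0# →
    ∀ {r} (x : Fin r → Fin m → Carrier) → (∀ j → FlowPolytope K G (x j)) → (∀ j → a · φ K R (x j) ≈ b) →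
    ∀ l → ∃[ e ] (label e ≡ l × (∀ j → x j e ≈ 0#))
  common-zero-on-route a b bound 0≤b b≉0 {zero} x flow a·x≈b l
    with Route.edges (route l) | route-path l | (λ {e} → label-unique {e} {l})
  -- Without flows to average any edge of the route serves; the route is nonempty because `source`
  -- is not `sink`.
  ... | e ∷ _ | _ | label≡l = e , label≡l (here ≡.refl) , λ ()
  common-zero-on-route a b bound 0≤b b≉0 {suc r} x flow a·x≈b l =
    let x̄ , flow-x̄ , a·x̄≈b , zeros = average a b x flow a·x≈b
        e , label≡l , x̄≈0 = zero-on-route a b bound 0≤b b≉0 x̄ flow-x̄ a·x̄≈b l
    in e , label≡l , zeros e x̄≈0

  module _ {x} (flow : FlowPolytope K G x) where

    private
      0≤x = proj₁ flow

      terms-zero : ∀ (f : Fin m → Vertex n) i → sum (λ e → x e * atᵛ (inner i) (f e)) ≈ 0# →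
                   ∀ {e} → f e ≡ inner i → x e ≈ 0#
      terms-zero f i s≈0 {e} f≡ = begin
        x e                                 ≈⟨ *-identityʳ (x e) ⟨
        x e * 1#                            ≈⟨ *-congˡ (𝟙-yes (f e ≟ inner i) f≡) ⟨
        x e * atᵛ (inner i) (f e)           ≈⟨ sum-nonNeg-zero (λ e → *-nonNeg (0≤x e) (0≤𝟙 (does (f e ≟ inner i)))) s≈0 e ⟩
        0#                                  ∎

      sum-zeros : ∀ (f : Fin m → Vertex n) i → (∀ {e} → f e ≡ inner i → x e ≈ 0#) →
                  sum (λ e → x e * atᵛ (inner i) (f e)) ≈ 0#
      sum-zeros f i x≈0 = sum-zero λ e → at e (f e ≟ inner i)
        where
        at : ∀ e (d : Dec (f e ≡ inner i)) → x e * 𝟙 (does d) ≈ 0#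
        at e (yes f≡) = trans (*-congʳ (x≈0 f≡)) (zeroˡ 1#)
        at e (no  _)  = zeroʳ (x e)

      balance : ∀ i → sum (λ e → x e * atᵛ (inner i) (tgt e)) ≈ sum (λ e → x e * atᵛ (inner i) (src e))
      balance i = trans (sym (inflow≈ x (inner i))) (trans (proj₁ (proj₂ flow) i) (outflow≈ x (inner i)))

    -- Conservation makes the outflow zero, and it is a sum of nonnegative terms.
    no-inflow⇒no-outflow : ∀ {i} → (∀ {e} → tgt e ≡ inner i → x e ≈ 0#) → ∀ {e} → src e ≡ inner i → x e ≈ 0#
    no-inflow⇒no-outflow {i} x≈0 = terms-zero src i (trans (sym (balance i)) (sum-zeros tgt i x≈0))

    no-outflow⇒no-inflow : ∀ {i} → (∀ {e} → src e ≡ inner i → x e ≈ 0#) → ∀ {e} → tgt e ≡ inner i → x e ≈ 0#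
    no-outflow⇒no-inflow {i} x≈0 = terms-zero tgt i (trans (balance i) (sum-zeros src i x≈0))

  private
    basis-elsewhere : ∀ {v l i p} → v ≢ inner i → basis K R v l i p ≈ 0#
    basis-elsewhere {source}  v≢ = refl
    basis-elsewhere {inner j} {l} {i} {p} v≢ = basis-≢ l p (v≢ ∘ ≡.cong inner)
    basis-elsewhere {sink}    v≢ = refl

  -- Only edges with an end at `i` contribute to the coordinates at `i`.
  φ-stagnant : ∀ {x i} → (∀ {e} → tgt e ≡ inner i → x e ≈ 0#) → (∀ {e} → src e ≡ inner i → x e ≈ 0#) →
               ∀ p → φ K R x i p ≈ 0#
  φ-stagnant {x} {i} in≈0 out≈0 p = sum-zero λ e → at e (tgt e ≟ inner i) (src e ≟ inner i)
    where
    at : ∀ e → Dec (tgt e ≡ inner i) → Dec (src e ≡ inner i) →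
         x e * (basis K R (tgt e) (label e) i p - basis K R (src e) (label e) i p) ≈ 0#
    at e (yes tgt≡) _          = trans (*-congʳ (in≈0 tgt≡)) (zeroˡ _)
    at e (no _)     (yes src≡) = trans (*-congʳ (out≈0 src≡)) (zeroˡ _)
    at e (no tgt≢)  (no src≢)  = trans (*-congˡ (trans
      (+-cong (basis-elsewhere {tgt e} tgt≢) (-‿cong (basis-elsewhere {src e} src≢))) (x-0≈x 0#))) (zeroʳ (x e))

-- Dimension counts and the facets of Q

≡-dimension⇒≡-suc : ∀ {δ r s} → δ ≡ r ℤ.⊖ 1 → δ ℤ.- ℤ.1ℤ ≡ s ℤ.⊖ 1 → r ≡ suc s
≡-dimension⇒≡-suc {r = zero}        {zero}  ≡.refl ()
≡-dimension⇒≡-suc {r = zero}        {suc s} ≡.refl ()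
-- A set of dimension 0 with the empty set, of dimension -1, as its facet.
≡-dimension⇒≡-suc {r = suc zero}    {zero}  ≡.refl _  = ≡.refl
≡-dimension⇒≡-suc {r = suc zero}    {suc s} ≡.refl ()
≡-dimension⇒≡-suc {r = suc (suc r)} {zero}  ≡.refl ()
≡-dimension⇒≡-suc {r = suc (suc r)} {suc s} ≡.refl eq = ≡.cong (λ t → ℕ.suc (ℕ.suc t)) (ℤ.+-injective eq)

module Facets {c ℓ₁ ℓ₂} (K : OrderedField c ℓ₁ ℓ₂) {n m k} {G : Graph n m}
  (unique-source : UniqueSource G) (unique-sink : UniqueSink G) (no-idle : NoIdleEdges G)
  (R : RouteDecomposition G k) where
  open Flows K R
  open Combinations K R using (common-zero-on-route; φ-stagnant; no-inflow⇒no-outflow; no-outflow⇒no-inflow)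
  open Graph G
  open RouteDecomposition R
  open Transversal using (pick)

  -- `base` marks the coordinate omitted in `ZeroSumSpace`; `other` provides a second coordinate,
  -- hence a nonzero difference of basis vectors at `i`.
  base other : ∀ i → Fin (indeg G (inner i))
  base  i = proj₁ (two-slots unique-source no-idle i)
  other i = proj₁ (proj₂ (two-slots unique-source no-idle i))

  other≢base : ∀ i → other i ≢ base i
  other≢base i = proj₂ (proj₂ (two-slots unique-source no-idle i))

  open ZeroSumSpace base

  origin : V K G
  origin _ _ = 0#

  origin∈Q : Q K R origin
  origin∈Q = 0∈Q unique-sink

  ∷-∈ : ∀ {ℓ r} {S : Pred (V K G) ℓ} {z} {pt : Fin r → V K G} → S z → (∀ j → S (pt j)) → ∀ j → S ((z Vec.∷ pt) j)
  ∷-∈ z∈S pt∈S zero    = z∈S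
  ∷-∈ z∈S pt∈S (suc j) = pt∈S j

  ZeroSums-bound : ∀ r → IndependentIn K (ZeroSums K G) r → r ℕ.≤ suc dim
  ZeroSums-bound r (pt , pt∈ , ind) = independent-bound pt pt∈ ind

  Q-bound : ∀ r → IndependentIn K (Q K R) r → r ℕ.≤ suc dim
  Q-bound r (pt , pt∈Q , ind) = ZeroSums-bound r (pt , (λ j → Q⊆ZeroSums (pt∈Q j)) , ind)

  Q-independent : IndependentIn K (Q K R) (suc dim)
  Q-independent =
    let pt , pt∈Q , ind = exists-independent (Q K R) (λ a norm (i , p , ap≉0) →
          -- A normalised functional is zero at `base i`, so this point detects its value at `p`.
          switch i p (base i) , switch∈Q i p (base i) , λ a·z≈0 → ap≉0 (begin
            a i p                      ≈⟨ x-0≈x (a i p) ⟨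
            a i p - 0#                 ≈⟨ +-congˡ (-‿cong (norm i)) ⟨
            a i p - a i (base i)       ≈⟨ ·-switch a i p (base i) ⟨
            a · switch i p (base i)    ≈⟨ a·z≈0 ⟩
            0#                         ∎)) dim ℕ.≤-refl
    in origin Vec.∷ pt , ∷-∈ {S = Q K R} origin∈Q pt∈Q , 0∷-affinely ind

  HasDim-Q : HasDim K (Q K R) (suc dim ℤ.⊖ 1)
  HasDim-Q = suc dim , ≡.refl , Q-independent , Q-bound

  full-dimensional : FullDimensionalIn K (Q K R) (ZeroSums K G)
  full-dimensional = Q⊆ZeroSums , suc dim ℤ.⊖ 1 , HasDim-Q ,
    (suc dim , ≡.refl , (proj₁ Q-independent , (λ j → Q⊆ZeroSums (proj₁ (proj₂ Q-independent) j)) , proj₂ (proj₂ Q-independent)) ,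
     ZeroSums-bound)

  module _ (M : Transversal R) where

    H⇒leftNormal : ∀ {y} → H K R M y → leftNormal M · y ≈ 1#
    H⇒leftNormal {y} y∈H = trans (sym (leftSum≈ M y)) y∈H

    leftNormal⇒H : ∀ {y} → leftNormal M · y ≈ 1# → H K R M y
    leftNormal⇒H {y} eq = trans (leftSum≈ M y) eq

    leftNormal-origin : ¬ leftNormal M · origin ≈ 1#
    leftNormal-origin eq = 0≉1 (trans (sym (·-zeroʳ (leftNormal M))) eq)

    -- The unpicked routes supply `dim` linearly independent points of the face. It has no more,
    -- since the origin lies in `Q` but off `H` and could be added to them.
    coverable⇒facet : Coverable R M → IsFacet K (Q K R) (Q K R ∩ H K R M)
    coverable⇒facet coverable = face , suc dim ℤ.⊖ 1 , HasDim-Q , dim , dim≡ , independent , bound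
      where
      open Coverings K R M
      face : IsFace K (Q K R) (Q K R ∩ H K R M)
      face = leftNormal M , 1# , (λ {y} y∈Q → ≤-respˡ-≈ (leftSum≈ M y) (Q⊆HalfSpace M y∈Q)) ,
        (λ (y∈Q , y∈H) → y∈Q , H⇒leftNormal y∈H) , (λ (y∈Q , eq) → y∈Q , leftNormal⇒H eq)
      dim≡ : suc dim ℤ.⊖ 1 ℤ.- ℤ.1ℤ ≡ dim ℤ.⊖ 1
      dim≡ = ≡.trans (≡.cong (ℤ._- ℤ.1ℤ) (ℤ.[1+m]⊖[1+n]≡m⊖n dim 0)) (ℤ.m-n≡m⊖n dim 1)
      independent : IndependentIn K (Q K R ∩ H K R M) dim
      independent =
        let pt , pt∈ , ind = exists-independent (Q K R ∩ H K R M) (λ a norm (i , p , ap≉0) →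
              separate (coverable⇒covered coverable) a p (base i) (norm i) ap≉0) dim ℕ.≤-refl
        in pt , pt∈ , linearly⇒affinely ind
      bound : ∀ r → IndependentIn K (Q K R ∩ H K R M) r → r ℕ.≤ dim
      bound r (pt , pt∈ , ind) = ℕ.s≤s⁻¹ (Q-bound (suc r) (origin Vec.∷ pt ,
        ∷-∈ {S = Q K R} origin∈Q (proj₁ ∘ pt∈) ,
        affinely-∷ (leftNormal M) 1# origin ind (λ j → H⇒leftNormal (proj₂ (pt∈ j))) leftNormal-origin))

    -- If `M′` picked an edge outside `M`, an unpicked route through that edge would lie in
    -- `H K R M` but not in `H K R M′`.
    coverable-⊆⇒≡ : ∀ M′ → Coverable R M → Q K R ∩ H K R M ⊆ Q K R ∩ H K R M′ → _≈ᵀ_ R M M′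
    coverable-⊆⇒≡ M′ coverable ⊆H′ j with picked? M (pick M′ j)
    ... | yes picked  = ≡.sym (≡.trans picked (≡.cong (pick M) (label-pick M′ j)))
    ... | no  ¬picked = contradiction
      (H⇒unpicked M′ (unpickedPoint∈Q P) (proj₂ (⊆H′ (unpickedPoint∈Q P , unpickedPoint∈H P))) (pick M′ j) (picked-pick M′ j))
      (χ-∈≉0 (∈-through covered (pick M′ j) ¬picked))
      where
      open Coverings K R M
      covered = coverable⇒covered coverable
      P = through covered (pick M′ j) ¬picked

  module FromFacet {ℓ} (F : Pred (V K G) ℓ) (a : V K G) (b : Carrier)
    (bound : ∀ {y} → Q K R y → a · y ≤ b) (F≐ : F ≐ (Q K R ∩ (λ y → a · y ≈ b)))
    {r} (F-independent : IndependentIn K F r) (F-maximal : ∀ s → IndependentIn K F s → s ℕ.≤ r)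
    (Q-independent : IndependentIn K (Q K R) (suc r)) (Q-maximal : ∀ s → IndependentIn K (Q K R) s → s ℕ.≤ suc r) where

    pt : Fin r → V K G
    pt = proj₁ F-independent

    pt∈Q : ∀ j → Q K R (pt j)
    pt∈Q j = proj₁ (proj₁ F≐ (proj₁ (proj₂ F-independent) j))

    a·pt≈b : ∀ j → a · pt j ≈ b
    a·pt≈b j = proj₂ (proj₁ F≐ (proj₁ (proj₂ F-independent) j))

    pt-independent : AffinelyIndependent K pt
    pt-independent = proj₂ (proj₂ F-independent)

    -- The dimension drops by just one from `Q` to the facet. The remaining arguments by
    -- contradiction violate this bound.
    no-two-more : ∀ {y z} → Q K R y → Q K R z → ¬ AffinelyIndependent K (z Vec.∷ (y Vec.∷ pt))
    no-two-more y∈Q z∈Q ind = ℕ.1+n≰n (Q-maximal (suc (suc r))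
      (_ , ∷-∈ {S = Q K R} z∈Q (∷-∈ {S = Q K R} y∈Q pt∈Q) , ind))

    0≤b : 0# ≤ b
    0≤b = ≤-respˡ-≈ (·-zeroʳ a) (bound origin∈Q)

    -- If `b` were zero, bounding `a` on switches in both directions would make it constant at each
    -- vertex. Then `a` would vanish on `Q`, and the facet would be all of `Q`.
    b≉0 : ¬ b ≈ 0#
    b≉0 b≈0 = ℕ.1+n≰n (F-maximal (suc r) (proj₁ Q-independent ,
      (λ j → Q⊆F (proj₁ (proj₂ Q-independent) j)) , proj₂ (proj₂ Q-independent)))
      where
      a≤ : ∀ i p q → a i p ≤ a i q
      a≤ i p q = 0≤y-x⇒x≤y (≤-respʳ-≈ (begin
        0# - (a i p - a i q)    ≈⟨ solve 3 (λ z x y → z :- (x :- y) := z :+ (y :- x)) refl 0# (a i p) (a i q) ⟩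
        0# + (a i q - a i p)    ≈⟨ +-identityˡ _ ⟩
        a i q - a i p           ∎)
        (x≤y⇒0≤y-x (≤-respʳ-≈ b≈0 (≤-respˡ-≈ (·-switch a i p q) (bound (switch∈Q i p q))))))
      Q⊆F : Q K R ⊆ F
      Q⊆F {y} y∈Q = proj₂ F≐ (y∈Q , trans (sum-zero λ i → begin
        sum (λ p → a i p * y i p)             ≈⟨ (sum-cong λ p → *-congʳ (antisym (a≤ i p (base i)) (a≤ i (base i) p))) ⟩
        sum (λ p → a i (base i) * y i p)      ≈⟨ *-distribˡ-sum (a i (base i)) (y i) ⟨
        a i (base i) * sum (y i)              ≈⟨ trans (*-congˡ (Q⊆ZeroSums y∈Q i)) (zeroʳ _) ⟩
        0#                                    ∎) (sym b≈0))

    flow : Fin r → Fin m → Carrier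
    flow j = proj₁ (pt∈Q j)

    flow∈ : ∀ j → FlowPolytope K G (flow j)
    flow∈ j = proj₁ (proj₂ (pt∈Q j))

    zero-edge : ∀ l → ∃[ e ] (label e ≡ l × (∀ j → flow j e ≈ 0#))
    zero-edge = common-zero-on-route a b bound 0≤b b≉0 flow flow∈
      λ j → trans (·-congˡ {a = a} (proj₂ (proj₂ (pt∈Q j)))) (a·pt≈b j)

    M : Transversal R
    M = record
      { pick   = λ l → proj₁ (zero-edge l)
      ; pick∈R = λ l → ∈-route (proj₁ (proj₂ (zero-edge l)))
      }

    flow-picked≈0 : ∀ j {e} → Picked M e → flow j e ≈ 0#
    flow-picked≈0 j {e} picked =
      trans (reflexive (≡.cong (flow j) picked)) (proj₂ (proj₂ (zero-edge (label e))) j)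

    leftNormal·pt≈1 : ∀ j → leftNormal M · pt j ≈ 1#
    leftNormal·pt≈1 j = H⇒leftNormal M (unpicked⇒H M (pt∈Q j) λ e → flow-picked≈0 j)

    -- A point of one side missing from the other could be added to `pt`: one of `a` and
    -- `leftNormal M` separates it from `pt`, and the other separates the origin from all of these.
    F≐Q∩H : F ≐ (Q K R ∩ H K R M)
    F≐Q∩H = (λ {y} y∈F → F⊆ y (proj₁ F≐ y∈F)) , (λ {y} → F⊇ y)
      where
      F⊆ : ∀ y → Q K R y × a · y ≈ b → (Q K R ∩ H K R M) y
      F⊆ y (y∈Q , a·y≈b) = y∈Q , leftNormal⇒H M (decidable-stable (leftNormal M · y ≈? 1#) λ ≉1 →
        no-two-more y∈Q origin∈Q (affinely-∷ a b origin
          (affinely-∷ (leftNormal M) 1# y pt-independent leftNormal·pt≈1 ≉1)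
          (∷-∈ {S = λ y → a · y ≈ b} a·y≈b a·pt≈b)
          (λ a·0≈b → b≉0 (trans (sym a·0≈b) (·-zeroʳ a)))))
      F⊇ : ∀ y → (Q K R ∩ H K R M) y → F y
      F⊇ y (y∈Q , y∈H) = proj₂ F≐ (y∈Q , decidable-stable (a · y ≈? b) λ ≉b →
        no-two-more y∈Q origin∈Q (affinely-∷ (leftNormal M) 1# origin
          (affinely-∷ a b y pt-independent a·pt≈b ≉b)
          (∷-∈ {S = λ y → leftNormal M · y ≈ 1#} (H⇒leftNormal M y∈H) leftNormal·pt≈1)
          (leftNormal-origin M)))

    -- Otherwise the origin, which is off `H`, and then a switch at `i`, the only point with a
    -- nonzero coordinate there, could be added to `pt`.
    not-stagnant : ∀ i → ¬ (∀ j p → pt j i p ≈ 0#)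
    not-stagnant i pt≈0 = no-two-more origin∈Q (switch∈Q i p q)
      (affinely-∷ u 0# (switch i p q)
        (affinely-∷ (leftNormal M) 1# origin pt-independent leftNormal·pt≈1 (leftNormal-origin M))
        (∷-∈ {S = λ y → u · y ≈ 0#} (·-zeroʳ u) λ j → trans (unit-· i p (pt j)) (pt≈0 j p))
        λ u·z≈0 → 0≉1 (begin
          0#                    ≈⟨ u·z≈0 ⟨
          u · switch i p q      ≈⟨ ·-switch u i p q ⟩
          u i p - u i q         ≈⟨ +-cong (unit-≡ i p) (-‿cong (unit-≢ (i , p) i q λ eq → other≢base i (snd-injective eq))) ⟩
          1# - 0#               ≈⟨ x-0≈x 1# ⟩
          1#                    ∎))
      where
      p = other i
      q = base i
      u = unit {d = λ i → indeg G (inner i)} (i , p)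
      snd-injective : ∀ {p q : Fin (indeg G (inner i))} →
                      _≡_ {A = Σ (Fin n) (λ i → Fin (indeg G (inner i)))} (i , p) (i , q) → p ≡ q
      snd-injective ≡.refl = ≡.refl

    pt-stagnant : ∀ i → (∀ j {e} → tgt e ≡ inner i → flow j e ≈ 0#) →
                  (∀ j {e} → src e ≡ inner i → flow j e ≈ 0#) → ∀ j p → pt j i p ≈ 0#
    pt-stagnant i in≈0 out≈0 j p = trans (sym (proj₂ (proj₂ (pt∈Q j)) i p)) (φ-stagnant {flow j} (in≈0 j) (out≈0 j) p)

    -- If every edge entering `i` were picked, no flow of the family would enter or, by
    -- conservation, leave `i`, and all of `pt` would vanish there.
    entrance : ∀ i → ∃[ e ] (tgt e ≡ inner i × ¬ Picked M e)
    entrance i = decidable-stable (Fin.any? λ e → (tgt e ≟ inner i) ×-dec ¬? (picked? M e)) λ none →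
      let in≈0 : ∀ j {e} → tgt e ≡ inner i → flow j e ≈ 0#
          in≈0 j {e} tgt≡ = flow-picked≈0 j (decidable-stable (picked? M e) λ ¬picked → none (e , tgt≡ , ¬picked))
      in not-stagnant i (pt-stagnant i in≈0 (λ j → no-inflow⇒no-outflow (flow∈ j) (in≈0 j)))

    exit : ∀ i → ∃[ e ] (src e ≡ inner i × ¬ Picked M e)
    exit i = decidable-stable (Fin.any? λ e → (src e ≟ inner i) ×-dec ¬? (picked? M e)) λ none →
      let out≈0 : ∀ j {e} → src e ≡ inner i → flow j e ≈ 0#
          out≈0 j {e} src≡ = flow-picked≈0 j (decidable-stable (picked? M e) λ ¬picked → none (e , src≡ , ¬picked))
      in not-stagnant i (pt-stagnant i (λ j → no-outflow⇒no-inflow (flow∈ j) (out≈0 j)) out≈0)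

    coverable : Coverable R M
    coverable = covered⇒coverable (locally⇒covered entrance exit)
      where open Coverings K R M

  facet⇒transversal : ∀ {ℓ} (F : Pred (V K G) ℓ) → IsFacet K (Q K R) F →
                      ∃! (_≈ᵀ_ R) (λ M → Coverable R M × F ≐ (Q K R ∩ H K R M))
  facet⇒transversal F ((a , b , bound , F≐) , δ , (r , δ≡ , Q-independent , Q-maximal) , (s , δ-1≡ , F-independent , F-maximal)) =
    transversal (≡-dimension⇒≡-suc {δ} {r} {s} δ≡ δ-1≡) Q-independent Q-maximal
    where
    -- Abstracting over `r` allows the equation `r ≡ suc s` to be matched with `refl`.
    transversal : ∀ {r} → r ≡ suc s → IndependentIn K (Q K R) r → (∀ t → IndependentIn K (Q K R) t → t ℕ.≤ r) →
                  ∃! (_≈ᵀ_ R) (λ M → Coverable R M × F ≐ (Q K R ∩ H K R M))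
    -- Uniqueness: another such transversal cuts out the same face, and `M` is coverable.
    transversal ≡.refl Q-independent Q-maximal = M , (coverable , F≐Q∩H) , λ {M′} (_ , F≐Q∩H′) →
      coverable-⊆⇒≡ M M′ coverable (λ y∈ → proj₁ F≐Q∩H′ (proj₂ F≐Q∩H y∈))
      where open FromFacet F a b bound F≐ F-independent F-maximal Q-independent Q-maximal

theorem5p11 : ∀ {c ℓ₁ ℓ₂} (K : OrderedField c ℓ₁ ℓ₂) {n m k} (G : Graph n m) →
    UniqueSource G → UniqueSink G → NoIdleEdges G → DegreeEquality G →
    (R : RouteDecomposition G k) →
    FullDimensionalIn K (Q K R) (ZeroSums K G)
    × ((M : Transversal R) → Coverable R M →
    Q K R ⊆ HalfSpace K R M × IsFacet K (Q K R) (Q K R ∩ H K R M))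
    × ((F : Pred (V K G) (c ⊔ ℓ₁ ⊔ ℓ₂)) → IsFacet K (Q K R) F →
    ∃! (_≈ᵀ_ R) (λ M → Coverable R M × F ≐ (Q K R ∩ H K R M)))
theorem5p11 K G unique-source unique-sink no-idle _ R =
  full-dimensional ,
  (λ M coverable → Flows.Q⊆HalfSpace K R M , coverable⇒facet M coverable) ,
  facet⇒transversal
  where open Facets K unique-source unique-sink no-idle R
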